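{- Let $n\ge 6$ be an even integer, let $c$ be an integer with $1<c<n/2$, let $S=\{\pm 1,\pm c,n/2\}\subseteq\mathbb{Z}_n$, and assume that $\Gamma=\mathrm{Cay}(\mathbb{Z}_n;S)$ is closed distance magic. Assume that there exists $j\in\mathcal{J}_n(S)$ which is of type $2$. Then the only elements of $\mathcal{J}_n(S)$ which are of type $2$ are $n/3$ and $2n/3$. In particular, $c$ is not divisible by $3$.
   Context: $\mathrm{Cay}(\mathbb{Z}_n;S)$ is the graph with vertex set $\mathbb{Z}_n$ in which $g,h$ are adjacent iff $h-g\in S$. A graph $\Gamma=(V,E)$ of order $n$ is closed distance magic if there are a bijection $\ell:V\to\{1,\ldots,n\}$ and a positive integer $r$ such that for all $u\in V$ the sum of the labels of $u$ and all its neighbors equals $r$. For $0\le j\le n-1$ let $\chi_j(x)=\cos(2\pi xj/n)+\mathbf{i}\sin(2\pi xj/n)$ and $\chi_j(S)=\sum_{x\in S}\chi_j(x)$; $\mathcal{J}_n(S)$ is the set of $j\in\{0,\ldots,n-1\}$ with $\chi_j(S)=-1$. An even $j\in\mathcal{J}_n(S)$ is of type $2$ if $\{\frac{2\pi j}{n},\frac{2\pi jc}{n}\}=\{\pm\frac{2\pi}{3}+2k_1\pi,\pm\frac{2\pi}{3}+2k_2\pi\}$ for some $k_1,k_2\in\mathbb{Z}$ and some (independent) choice of signs. -}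

module Defs where

open import Data.Fin.Base using (Fin; toℕ; fromℕ<)
open import Data.Fin.Properties using () renaming (_≟_ to _≟ᶠ_)
open import Data.Fin.Subset using (Subset; _∈_; ⁅_⁆; _∪_)
open import Data.Fin.Subset.Properties using (_∈?_)
open import Data.Integer.Base as ℤ using (ℤ; +_; -[1+_])
open import Data.Integer.DivMod using (_%ℕ_; n%ℕd<d)
import Data.Integer.Properties as ℤₚ
open import Data.List.Base using (List; filter; allFin; map; foldr)
open import Data.Nat.Base as ℕ using (ℕ; zero; suc)
open import Data.Nat.Divisibility using (_∣_)
open import Data.Nat.ListAction using (sum)
import Data.Nat.Properties as ℕₚ
open import Data.Product.Base using (_×_; _,_; proj₁; proj₂; ∃-syntax; Σ-syntax)
open import Data.Rational.Base
open import Data.Rational.Properties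
open import Data.Rational.Solver using (module +-*-Solver)
import Data.Rational.Unnormalised.Base as ℚᵘ
import Data.Rational.Unnormalised.Properties as ℚᵘₚ
open import Data.Sign.Base using (Sign)
open import Data.Sum.Base using (_⊎_; inj₁; inj₂)
open import Function.Bundles using (_⤖_; Bijection)
open import Level using (0ℓ)
open import Relation.Binary.Core using (Rel)
open import Relation.Binary.Definitions using (Decidable)
open import Relation.Binary.PropositionalEquality
  using (_≡_; refl; sym; trans; cong; cong₂; subst)
open import Relation.Nullary.Decidable.Core using (_⊎-dec_)
open import Relation.Nullary.Negation.Core using (¬_)
open import Relation.Unary using (Pred; _≐_)

open +-*-Solver using (solve; _:+_; _:*_; _:-_; :-_; _:=_; con)

Cauchy : (ℕ → ℚ) → Set
Cauchy x = ∀ ε → 0ℚ < ε →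
  ∃[ N ] (∀ m n → N ℕ.≤ m → N ℕ.≤ n → ∣ x m - x n ∣ < ε)

record ℝ : Set where
  constructor mkℝ
  field
    seq    : ℕ → ℚ
    cauchy : Cauchy seq

open ℝ public

infix 4 _≃ᵣ_ _<ᵣ_

_≃ᵣ_ : Rel ℝ 0ℓ
x ≃ᵣ y = ∀ ε → 0ℚ < ε →
  ∃[ N ] (∀ n → N ℕ.≤ n → ∣ seq x n - seq y n ∣ < ε)

_<ᵣ_ : Rel ℝ 0ℓ
x <ᵣ y = ∃[ ε ] (0ℚ < ε ×
  ∃[ N ] (∀ n → N ℕ.≤ n → seq x n + ε ≤ seq y n))

nat : ℕ → ℚ
nat k = + k / 1

recip : ℕ → ℚ
recip k = + 1 / suc k

0≤1 : 0ℚ ≤ 1ℚ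
0≤1 = *≤* (ℤ.+≤+ ℕ.z≤n)

*-mono : ∀ {a b c d} → 0ℚ ≤ a → a ≤ b → 0ℚ ≤ c → c ≤ d → a * c ≤ b * d
*-mono {a} {b} {c} 0≤a a≤b 0≤c c≤d = ≤-trans
  (*-monoʳ-≤-nonNeg c {{nonNegative 0≤c}} a≤b)
  (*-monoˡ-≤-nonNeg b {{nonNegative (≤-trans 0≤a a≤b)}} c≤d)

*-nonneg : ∀ {a b} → 0ℚ ≤ a → 0ℚ ≤ b → 0ℚ ≤ a * b
*-nonneg {a} {b} 0≤a 0≤b =
  subst (_≤ a * b) (*-zeroˡ 0ℚ) (*-mono ≤-refl 0≤a ≤-refl 0≤b)

*-pos : ∀ {a b} → 0ℚ < a → 0ℚ < b → 0ℚ < a * b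
*-pos {a} {b} 0<a 0<b = subst (_< a * b) (*-zeroʳ a)
  (*-monoʳ-<-pos a {{positive 0<a}} 0<b)

+-nonneg : ∀ {a b} → 0ℚ ≤ a → 0ℚ ≤ b → 0ℚ ≤ a + b
+-nonneg = +-mono-≤

nat-ᵘ : ∀ k → toℚᵘ (nat k) ℚᵘ.≃ ℚᵘ.mkℚᵘ (+ k) 0
nat-ᵘ k = toℚᵘ-fromℚᵘ (ℚᵘ.mkℚᵘ (+ k) 0)

recip-ᵘ : ∀ k → toℚᵘ (recip k) ℚᵘ.≃ ℚᵘ.mkℚᵘ (+ 1) k
recip-ᵘ k = toℚᵘ-fromℚᵘ (ℚᵘ.mkℚᵘ (+ 1) k)

recip*nat : ∀ k → recip k * nat (suc k) ≡ 1ℚ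
recip*nat k = toℚᵘ-injective (ℚᵘₚ.≃-trans (toℚᵘ-homo-* (recip k) (nat (suc k)))
  (ℚᵘₚ.≃-trans (ℚᵘₚ.*-cong (recip-ᵘ k) (nat-ᵘ (suc k)))
    (ℚᵘ.*≡* (trans (ℤₚ.*-identityʳ (+ 1 ℤ.* + suc k))
      (cong (λ z → + 1 ℤ.* + z) (sym (ℕₚ.*-identityʳ (suc k))))))))

nat-suc : ∀ k → nat (suc k) ≡ nat k + 1ℚ
nat-suc k = toℚᵘ-injective (ℚᵘₚ.≃-trans (nat-ᵘ (suc k)) (ℚᵘₚ.≃-sym
  (ℚᵘₚ.≃-trans (toℚᵘ-homo-+ (nat k) 1ℚ)
    (ℚᵘₚ.≃-trans (ℚᵘₚ.+-cong (nat-ᵘ k) (ℚᵘₚ.≃-refl {toℚᵘ 1ℚ}))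
      (ℚᵘ.*≡* (cong (ℤ._* + 1) (trans (cong (ℤ._+ + 1) (ℤₚ.*-identityʳ (+ k)))
        (cong +_ (ℕₚ.+-comm k 1)))))))))

recip-pos : ∀ k → 0ℚ < recip k
recip-pos k = positive⁻¹ (recip k) {{normalize-pos 1 (suc k)}}

nat-pos : ∀ k → 0ℚ < nat (suc k)
nat-pos k = positive⁻¹ (nat (suc k)) {{normalize-pos (suc k) 1}}

nat-mono : ∀ {m n} → m ℕ.≤ n → nat m ≤ nat n
nat-mono {m} {n} m≤n = toℚᵘ-cancel-≤
  (ℚᵘₚ.≤-respʳ-≃ (ℚᵘₚ.≃-sym (nat-ᵘ n)) (ℚᵘₚ.≤-respˡ-≃ (ℚᵘₚ.≃-sym (nat-ᵘ m))
    (ℚᵘ.*≤* (ℤₚ.*-monoʳ-≤-nonNeg (+ 1) (ℤ.+≤+ m≤n)))))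

archimedean : ∀ q → ∃[ N ] q ≤ nat N
archimedean q@(mkℚ (+ a) d _) = a , toℚᵘ-cancel-≤
  (ℚᵘₚ.≤-respʳ-≃ (ℚᵘₚ.≃-sym (nat-ᵘ a))
    (ℚᵘ.*≤* (ℤₚ.*-monoˡ-≤-nonNeg (+ a) (ℤ.+≤+ (ℕ.s≤s ℕ.z≤n)))))
archimedean (mkℚ -[1+ a ] d _) = 0 , *≤* ℤ.-≤+

archimedean-* : ∀ K ε → 0ℚ < ε → ∃[ N ] K ≤ nat N * ε
archimedean-* K ε 0<ε = let
    instance _ = >-nonZero 0<ε
    N , h = archimedean (K * 1/ ε)
  in N , subst (_≤ nat N * ε)
    (trans (*-assoc K (1/ ε) ε)
      (trans (cong (K *_) (*-inverseˡ ε)) (*-identityʳ K)))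
    (*-monoʳ-≤-nonNeg ε {{nonNegative (<⇒≤ 0<ε)}} h)

third : ℚ
third = + 1 / 3

third-pos : ∀ {ε} → 0ℚ < ε → 0ℚ < third * ε
third-pos = *-pos (positive⁻¹ third)

half-pos : ∀ {ε} → 0ℚ < ε → 0ℚ < ½ * ε
half-pos = *-pos (positive⁻¹ ½)

thirds : ∀ ε → third * ε + third * ε + third * ε ≡ ε
thirds = solve 1 (λ e → con third :* e :+ con third :* e :+ con third :* e := e) refl

halves : ∀ ε → ½ * ε + ½ * ε ≡ ε
halves = solve 1 (λ e → con ½ :* e :+ con ½ :* e := e) refl

p≤p+q : ∀ {p q} → 0ℚ ≤ q → p ≤ p + q
p≤p+q {p} {q} 0≤q = subst (_≤ p + q) (+-identityʳ p) (+-monoʳ-≤ p 0≤q)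

abs-0 : ∀ {p} → p ≡ 0ℚ → ∣ p ∣ ≤ 0ℚ
abs-0 refl = ≤-refl

eventuallyBounded : ∀ {x} → Cauchy x →
  ∃[ N ] ∃[ B ] (0ℚ ≤ B × (∀ n → N ℕ.≤ n → ∣ x n ∣ ≤ B))
eventuallyBounded {x} cx = let N , h = cx 1ℚ (positive⁻¹ 1ℚ) in
  N , 1ℚ + ∣ x N ∣ , +-nonneg 0≤1 (0≤∣p∣ (x N)) , λ n N≤n →
    ≤-trans (subst (λ z → ∣ z ∣ ≤ ∣ x n - x N ∣ + ∣ x N ∣)
        (solve 2 (λ a b → a :- b :+ b := a) refl (x n) (x N))
        (∣p+q∣≤∣p∣+∣q∣ (x n - x N) (x N)))
      (+-monoˡ-≤ ∣ x N ∣ (<⇒≤ (h n N N≤n ℕₚ.≤-refl)))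

infixl 6 _+ᵣ_
infixr 7 _·_

fromℚ : ℚ → ℝ
fromℚ q = mkℝ (λ _ → q) λ ε 0<ε → 0 , λ _ _ _ _ →
  ≤-<-trans (abs-0 (+-inverseʳ q)) 0<ε

_+ᵣ_ : ℝ → ℝ → ℝ
mkℝ x cx +ᵣ mkℝ y cy = mkℝ (λ n → x n + y n) λ ε 0<ε → let
    M , p = cx (½ * ε) (half-pos 0<ε)
    N , q = cy (½ * ε) (half-pos 0<ε)
  in M ℕ.⊔ N , λ m n h k → subst
    (λ z → ∣ z ∣ < ε)
    (solve 4 (λ a b c d → (a :- c) :+ (b :- d) := (a :+ b) :- (c :+ d)) refl
      (x m) (y m) (x n) (y n))
    (≤-<-trans (∣p+q∣≤∣p∣+∣q∣ (x m - x n) (y m - y n))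
      (subst (∣ x m - x n ∣ + ∣ y m - y n ∣ <_) (halves ε) (+-mono-<
        (p m n (ℕₚ.≤-trans (ℕₚ.m≤m⊔n M N) h) (ℕₚ.≤-trans (ℕₚ.m≤m⊔n M N) k))
        (q m n (ℕₚ.≤-trans (ℕₚ.m≤n⊔m M N) h) (ℕₚ.≤-trans (ℕₚ.m≤n⊔m M N) k)))))

_·_ : ℚ → ℝ → ℝ
q · mkℝ x cx = mkℝ (λ n → q * x n) λ ε 0<ε → let
    P , K≤ = archimedean ∣ q ∣
    N , p = cx (recip P * ε) (*-pos (recip-pos P) 0<ε)
  in N , λ m n h k → subst (_< ε)
    (trans (sym (∣p*q∣≡∣p∣*∣q∣ q (x m - x n)))
      (cong ∣_∣ (solve 3 (λ a b c → a :* (b :- c) := a :* b :- a :* c) refl q (x m) (x n))))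
    (≤-<-trans
      (*-mono (0≤∣p∣ q) (≤-trans K≤ (nat-mono (ℕₚ.n≤1+n P))) (0≤∣p∣ (x m - x n)) ≤-refl)
      (subst (nat (suc P) * ∣ x m - x n ∣ <_)
        (trans (sym (*-assoc (nat (suc P)) (recip P) ε))
          (trans (cong (_* ε) (trans (*-comm (nat (suc P)) (recip P)) (recip*nat P)))
            (*-identityˡ ε)))
        (*-monoʳ-<-pos (nat (suc P)) {{positive (nat-pos P)}} (p m n h k))))

-- x ^ k / k !
term : ℕ → ℚ → ℚ
term zero    x = 1ℚ
term (suc k) x = term k x * x * recip k

-- Σ_{k<n} D k · x^k / k!
partialSum : (ℕ → ℚ) → ℕ → ℚ → ℚ
partialSum D zero    x = 0ℚ
partialSum D (suc n) x = partialSum D n x + D n * term n x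

-- Partial sums of the exponential series, which dominate all the others.
E : ℕ → ℚ → ℚ
E zero    B = 0ℚ
E (suc n) B = E n B + term n B

term-nonneg : ∀ k {B} → 0ℚ ≤ B → 0ℚ ≤ term k B
term-nonneg zero    0≤B = 0≤1
term-nonneg (suc k) 0≤B =
  *-nonneg (*-nonneg (term-nonneg k 0≤B) 0≤B) (<⇒≤ (recip-pos k))

abs-recip : ∀ k → ∣ recip k ∣ ≡ recip k
abs-recip k = 0≤p⇒∣p∣≡p (<⇒≤ (recip-pos k))

term-abs : ∀ k {x B} → ∣ x ∣ ≤ B → ∣ term k x ∣ ≤ term k B
term-abs zero    h = ≤-refl
term-abs (suc k) {x} {B} h = subst (_≤ term (suc k) B)
  (sym (trans (∣p*q∣≡∣p∣*∣q∣ (term k x * x) (recip k))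
    (cong₂ _*_ (∣p*q∣≡∣p∣*∣q∣ (term k x) x) (abs-recip k))))
  (*-monoʳ-≤-nonNeg (recip k) {{nonNegative (<⇒≤ (recip-pos k))}}
    (*-mono (0≤∣p∣ (term k x)) (term-abs k h) (0≤∣p∣ x) h))

term-step : ∀ k B → term (suc k) B * nat (suc k) ≡ term k B * B
term-step k B = trans (*-assoc (term k B * B) (recip k) (nat (suc k)))
  (trans (cong (term k B * B *_) (recip*nat k)) (*-identityʳ (term k B * B)))

term-lipschitz : ∀ k {x y B} → ∣ x ∣ ≤ B → ∣ y ∣ ≤ B →
  ∣ term (suc k) x - term (suc k) y ∣ ≤ term k B * ∣ x - y ∣
term-lipschitz zero {x} {y} hx hy = ≤-reflexive
  (trans (cong ∣_∣ (solve 2 (λ a b →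
      con 1ℚ :* a :* con 1ℚ :- con 1ℚ :* b :* con 1ℚ := a :- b) refl x y))
    (sym (*-identityˡ ∣ x - y ∣)))
term-lipschitz (suc k) {x} {y} {B} hx hy =
  subst (λ z → ∣ z ∣ ≤ tB * d) (sym split)
    (subst₂′ (∣p*q∣≡∣p∣*∣q∣ (a + b) r) collapse
      (subst (λ z → ∣ a + b ∣ * ∣ r ∣ ≤ (tB * d + term k B * d * B) * z)
        (abs-recip (suc k))
        (*-monoʳ-≤-nonNeg ∣ r ∣ {{∣-∣-nonNeg r}}
          (≤-trans (∣p+q∣≤∣p∣+∣q∣ a b) (+-mono-≤ boundA boundB)))))
  where
  r = recip (suc k)
  tx = term (suc k) x
  ty = term (suc k) y
  tB = term (suc k) B
  d = ∣ x - y ∣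
  a = tx * (x - y)
  b = (tx - ty) * y
  split : term (suc (suc k)) x - term (suc (suc k)) y ≡ (a + b) * r
  split = solve 5 (λ p q x y r →
    p :* x :* r :- q :* y :* r := (p :* (x :- y) :+ (p :- q) :* y) :* r) refl tx ty x y r
  0≤B : 0ℚ ≤ B
  0≤B = ≤-trans (0≤∣p∣ x) hx
  boundA : ∣ a ∣ ≤ tB * d
  boundA = subst (_≤ tB * d) (sym (∣p*q∣≡∣p∣*∣q∣ tx (x - y)))
    (*-mono (0≤∣p∣ tx) (term-abs (suc k) hx) (0≤∣p∣ (x - y)) ≤-refl)
  boundB : ∣ b ∣ ≤ term k B * d * B
  boundB = subst (_≤ term k B * d * B) (sym (∣p*q∣≡∣p∣*∣q∣ (tx - ty) y))
    (*-mono (0≤∣p∣ (tx - ty)) (term-lipschitz k hx hy) (0≤∣p∣ y) hy)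
  subst₂′ : ∀ {p q s t} → p ≡ q → s ≡ t → q ≤ s → p ≤ t
  subst₂′ refl refl h = h
  collapse : (tB * d + term k B * d * B) * r ≡ tB * d
  collapse = trans (cong (λ z → (tB * d + z) * r)
      (trans (solve 3 (λ t d B → t :* d :* B := t :* B :* d) refl (term k B) d B)
        (cong (_* d) (sym (term-step k B)))))
    (trans (solve 4 (λ t d n r →
        (t :* d :+ t :* n :* d) :* r := t :* d :* (r :* (n :+ con 1ℚ))) refl
        tB d (nat (suc k)) r)
      (trans (cong (λ z → tB * d * (r * z)) (sym (nat-suc (suc k))))
        (trans (cong (tB * d *_) (recip*nat (suc k))) (*-identityʳ (tB * d)))))

E-mono : ∀ {B} → 0ℚ ≤ B → ∀ n i → E n B ≤ E (n ℕ.+ i) B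
E-mono 0≤B n zero rewrite ℕₚ.+-identityʳ n = ≤-refl
E-mono 0≤B n (suc i) rewrite ℕₚ.+-suc n i =
  ≤-trans (E-mono 0≤B n i) (p≤p+q (term-nonneg (n ℕ.+ i) 0≤B))

E-nonneg : ∀ {B} → 0ℚ ≤ B → ∀ n → 0ℚ ≤ E n B
E-nonneg 0≤B n = E-mono 0≤B 0 n

module Majorant {B} (0≤B : 0ℚ ≤ B) where

  M : ℕ
  M = proj₁ (archimedean (B + B))

  2B≤M : B + B ≤ nat M
  2B≤M = proj₂ (archimedean (B + B))

  halving : ∀ n → M ℕ.≤ n → term (suc n) B + term (suc n) B ≤ term n B
  halving n M≤n = *-cancelʳ-≤-pos (nat (suc n)) {{positive (nat-pos n)}}
    (subst (_≤ term n B * nat (suc n))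
      (sym (trans (*-distribʳ-+ (nat (suc n)) (term (suc n) B) (term (suc n) B))
        (trans (cong₂ _+_ (term-step n B) (term-step n B))
          (sym (*-distribˡ-+ (term n B) B B)))))
      (*-monoˡ-≤-nonNeg (term n B) {{nonNegative (term-nonneg n 0≤B)}}
        (≤-trans 2B≤M (nat-mono (ℕₚ.m≤n⇒m≤1+n M≤n)))))

  term-decr : ∀ i → term (M ℕ.+ i) B ≤ term M B
  term-decr zero rewrite ℕₚ.+-identityʳ M = ≤-refl
  term-decr (suc i) rewrite ℕₚ.+-suc M i = ≤-trans
    (p≤p+q (term-nonneg (suc (M ℕ.+ i)) 0≤B))
    (≤-trans (halving (M ℕ.+ i) (ℕₚ.m≤m+n M i)) (term-decr i))

  potential : ∀ n → M ℕ.≤ n → ∀ i →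
    E (n ℕ.+ i) B + (term (n ℕ.+ i) B + term (n ℕ.+ i) B) ≤ E n B + (term n B + term n B)
  potential n M≤n zero rewrite ℕₚ.+-identityʳ n = ≤-refl
  potential n M≤n (suc i) rewrite ℕₚ.+-suc n i = ≤-trans
    (subst (E k B + term k B + (term (suc k) B + term (suc k) B) ≤_)
      (+-assoc (E k B) (term k B) (term k B))
      (+-monoʳ-≤ (E k B + term k B) (halving k (ℕₚ.m≤n⇒m≤n+o i M≤n))))
    (potential n M≤n i)
    where k = n ℕ.+ i

  tail : ∀ n → M ℕ.≤ n → ∀ i → E (n ℕ.+ i) B - E n B ≤ term n B + term n B
  tail n M≤n i = subst (E (n ℕ.+ i) B - E n B ≤_)
    (solve 2 (λ e t → e :+ t :- e := t) refl (E n B) (term n B + term n B))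
    (+-monoˡ-≤ (- E n B) (≤-trans
      (p≤p+q {E (n ℕ.+ i) B} (+-nonneg (term-nonneg (n ℕ.+ i) 0≤B) (term-nonneg (n ℕ.+ i) 0≤B)))
      (potential n M≤n i)))

  bound : ℚ
  bound = E M B + (term M B + term M B)

  E≤bound : ∀ n → E n B ≤ bound
  E≤bound n = ≤-trans (E-mono 0≤B n M)
    (subst (λ z → E z B ≤ bound) (ℕₚ.+-comm M n)
      (≤-trans (p≤p+q (+-nonneg (term-nonneg (M ℕ.+ n) 0≤B) (term-nonneg (M ℕ.+ n) 0≤B)))
        (potential M ℕₚ.≤-refl n)))

  term-small : ∀ ε → 0ℚ < ε → ∃[ N ] (M ℕ.≤ suc N × term (suc N) B ≤ ε)
  term-small ε 0<ε = let P , h = archimedean-* (term M B * B) ε 0<ε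
                         N = M ℕ.+ P in
    N , ℕₚ.m≤n⇒m≤1+n (ℕₚ.m≤m+n M P) ,
    *-cancelʳ-≤-pos (nat (suc N)) {{positive (nat-pos N)}}
      (≤-trans (≤-reflexive (term-step N B))
        (≤-trans (*-mono (term-nonneg N 0≤B) (term-decr P) 0≤B ≤-refl)
          (≤-trans h (≤-trans
            (*-monoʳ-≤-nonNeg ε {{nonNegative (<⇒≤ 0<ε)}}
              (nat-mono (ℕₚ.m≤n⇒m≤1+n (ℕₚ.m≤n+m P M))))
            (≤-reflexive (*-comm (nat (suc N)) ε))))))

module Series {D : ℕ → ℚ} (D≤1 : ∀ k → ∣ D k ∣ ≤ 1ℚ) where

  coeff : ∀ k z {T} → ∣ z ∣ ≤ T → ∣ D k * z ∣ ≤ T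
  coeff k z {T} h = subst (_≤ T) (sym (∣p*q∣≡∣p∣*∣q∣ (D k) z))
    (subst (∣ D k ∣ * ∣ z ∣ ≤_) (*-identityˡ T)
      (*-mono (0≤∣p∣ (D k)) (D≤1 k) (0≤∣p∣ z) h))

  partialSum-tail : ∀ {x B} → ∣ x ∣ ≤ B → ∀ n i →
    ∣ partialSum D (n ℕ.+ i) x - partialSum D n x ∣ ≤ E (n ℕ.+ i) B - E n B
  partialSum-tail {x} {B} h n zero rewrite ℕₚ.+-identityʳ n = ≤-trans
    (abs-0 (+-inverseʳ (partialSum D n x))) (≤-reflexive (sym (+-inverseʳ (E n B))))
  partialSum-tail {x} {B} h n (suc i) rewrite ℕₚ.+-suc n i =
    subst (λ z → ∣ z ∣ ≤ E k B + term k B - E n B)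
      (solve 3 (λ p q r → (p :- q) :+ r := p :+ r :- q) refl
        (partialSum D k x) (partialSum D n x) (D k * term k x))
      (≤-trans (∣p+q∣≤∣p∣+∣q∣ (partialSum D k x - partialSum D n x) (D k * term k x))
        (subst (∣ partialSum D k x - partialSum D n x ∣ + ∣ D k * term k x ∣ ≤_)
          (solve 3 (λ p q r → (p :- q) :+ r := p :+ r :- q) refl
            (E k B) (E n B) (term k B))
          (+-mono-≤ (partialSum-tail h n i) (coeff k (term k x) (term-abs k h)))))
    where k = n ℕ.+ i

  partialSum-lipschitz : ∀ {x y B} → ∣ x ∣ ≤ B → ∣ y ∣ ≤ B → ∀ n →
    ∣ partialSum D (suc n) x - partialSum D (suc n) y ∣ ≤ E n B * ∣ x - y ∣
  partialSum-lipschitz {x} {y} hx hy zero = ≤-trans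
    (abs-0 (+-inverseʳ (0ℚ + D 0 * 1ℚ))) (≤-reflexive (sym (*-zeroˡ ∣ x - y ∣)))
  partialSum-lipschitz {x} {y} {B} hx hy (suc n) =
    subst (λ z → ∣ z ∣ ≤ (E n B + term n B) * ∣ x - y ∣)
      (solve 5 (λ p q d s t → (p :- q) :+ d :* (s :- t) := (p :+ d :* s) :- (q :+ d :* t))
        refl px py (D (suc n)) tx ty)
      (≤-trans (∣p+q∣≤∣p∣+∣q∣ (px - py) (D (suc n) * (tx - ty)))
        (subst (∣ px - py ∣ + ∣ D (suc n) * (tx - ty) ∣ ≤_)
          (sym (*-distribʳ-+ ∣ x - y ∣ (E n B) (term n B)))
          (+-mono-≤ (partialSum-lipschitz hx hy n)
            (coeff (suc n) (tx - ty) (term-lipschitz n hx hy)))))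
    where
    px = partialSum D (suc n) x
    py = partialSum D (suc n) y
    tx = term (suc n) x
    ty = term (suc n) y

  series-cauchy : ∀ {x} → Cauchy x → Cauchy (λ n → partialSum D n (x n))
  series-cauchy {x} cx ε 0<ε = L , close
    where
    bdd = eventuallyBounded {x} cx
    N₀ = proj₁ bdd
    B = proj₁ (proj₂ bdd)
    0≤B = proj₁ (proj₂ (proj₂ bdd))
    x≤B = proj₂ (proj₂ (proj₂ bdd))
    open Majorant 0≤B
    δ = third * ε
    0<δ = third-pos 0<ε
    small = term-small (½ * δ) (half-pos 0<δ)
    N = suc (proj₁ small)
    arch = archimedean bound
    P = proj₁ arch
    modulus = cx (recip P * δ) (*-pos (recip-pos P) 0<δ)
    N₁ = proj₁ modulus
    L = N₀ ℕ.⊔ (N ℕ.⊔ N₁)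
    s : ℕ → ℚ → ℚ
    s = partialSum D

    L⇒N₀ : ∀ {m} → L ℕ.≤ m → N₀ ℕ.≤ m
    L⇒N₀ = ℕₚ.≤-trans (ℕₚ.m≤m⊔n N₀ (N ℕ.⊔ N₁))
    L⇒N : ∀ {m} → L ℕ.≤ m → N ℕ.≤ m
    L⇒N h = ℕₚ.≤-trans (ℕₚ.m≤m⊔n N N₁) (ℕₚ.≤-trans (ℕₚ.m≤n⊔m N₀ (N ℕ.⊔ N₁)) h)
    L⇒N₁ : ∀ {m} → L ℕ.≤ m → N₁ ℕ.≤ m
    L⇒N₁ h = ℕₚ.≤-trans (ℕₚ.m≤n⊔m N N₁) (ℕₚ.≤-trans (ℕₚ.m≤n⊔m N₀ (N ℕ.⊔ N₁)) h)

    truncation : ∀ m → L ℕ.≤ m → ∣ s m (x m) - s N (x m) ∣ ≤ δ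
    truncation m h = subst (λ k → ∣ s k (x m) - s N (x m) ∣ ≤ δ)
      (ℕₚ.m+[n∸m]≡n (L⇒N h))
      (≤-trans (partialSum-tail {x m} (x≤B m (L⇒N₀ h)) N (m ℕ.∸ N))
        (≤-trans (tail N (proj₁ (proj₂ small)) (m ℕ.∸ N))
          (≤-trans (+-mono-≤ (proj₂ (proj₂ small)) (proj₂ (proj₂ small)))
            (≤-reflexive (halves δ)))))

    middle : ∀ m n → L ℕ.≤ m → L ℕ.≤ n → ∣ s N (x m) - s N (x n) ∣ < δ
    middle m n h k = ≤-<-trans
      (partialSum-lipschitz {x m} {x n} (x≤B m (L⇒N₀ h)) (x≤B n (L⇒N₀ k)) (proj₁ small))
      (≤-<-trans
        (*-mono (E-nonneg 0≤B (proj₁ small))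
          (≤-trans (E≤bound (proj₁ small)) (≤-trans (proj₂ arch) (nat-mono (ℕₚ.n≤1+n P))))
          (0≤∣p∣ (x m - x n)) ≤-refl)
        (subst (nat (suc P) * ∣ x m - x n ∣ <_)
          (trans (sym (*-assoc (nat (suc P)) (recip P) δ))
            (trans (cong (_* δ) (trans (*-comm (nat (suc P)) (recip P)) (recip*nat P)))
              (*-identityˡ δ)))
          (*-monoʳ-<-pos (nat (suc P)) {{positive (nat-pos P)}}
            (proj₂ modulus m n (L⇒N₁ h) (L⇒N₁ k)))))

    close : ∀ m n → L ℕ.≤ m → L ℕ.≤ n → ∣ s m (x m) - s n (x n) ∣ < ε
    close m n h k = subst (λ z → ∣ z ∣ < ε)
      (solve 4 (λ a b c d → (a :- b) :+ (b :- c) :+ (:- (d :- c)) := a :- d) refl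
        (s m (x m)) (s N (x m)) (s N (x n)) (s n (x n)))
      (≤-<-trans (≤-trans (∣p+q∣≤∣p∣+∣q∣ (u + v) (- w))
          (+-mono-≤ (∣p+q∣≤∣p∣+∣q∣ u v) (≤-reflexive (∣-p∣≡∣p∣ w))))
        (subst (∣ u ∣ + ∣ v ∣ + ∣ w ∣ <_) (thirds ε)
          (+-mono-<-≤ (+-mono-≤-< (truncation m h) (middle m n h k)) (truncation n k))))
      where
      u = s m (x m) - s N (x m)
      v = s N (x m) - s N (x n)
      w = s n (x n) - s N (x n)

-- The k-th derivatives of cos and sin at 0.
cosCoeff sinCoeff : ℕ → ℚ
cosCoeff 0             = 1ℚ
cosCoeff 1             = 0ℚ
cosCoeff (suc (suc k)) = - cosCoeff k
sinCoeff 0             = 0ℚ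
sinCoeff 1             = 1ℚ
sinCoeff (suc (suc k)) = - sinCoeff k

cosCoeff≤1 : ∀ k → ∣ cosCoeff k ∣ ≤ 1ℚ
cosCoeff≤1 0             = ≤-refl
cosCoeff≤1 1             = 0≤1
cosCoeff≤1 (suc (suc k)) =
  subst (_≤ 1ℚ) (sym (∣-p∣≡∣p∣ (cosCoeff k))) (cosCoeff≤1 k)

sinCoeff≤1 : ∀ k → ∣ sinCoeff k ∣ ≤ 1ℚ
sinCoeff≤1 0             = 0≤1
sinCoeff≤1 1             = ≤-refl
sinCoeff≤1 (suc (suc k)) =
  subst (_≤ 1ℚ) (sym (∣-p∣≡∣p∣ (sinCoeff k))) (sinCoeff≤1 k)

-- The n-th approximation is the n-th partial sum of the Taylor series,
-- evaluated at the n-th approximation of x.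
cos sin : ℝ → ℝ
cos (mkℝ x cx) = mkℝ (λ n → partialSum cosCoeff n (x n)) (Series.series-cauchy cosCoeff≤1 cx)
sin (mkℝ x cx) = mkℝ (λ n → partialSum sinCoeff n (x n)) (Series.series-cauchy sinCoeff≤1 cx)

-- π is the least positive zero of sin; this determines it up to _≃ᵣ_.
record IsPi (π : ℝ) : Set where
  field
    0<π    : fromℚ 0ℚ <ᵣ π
    sinπ≃0 : sin π ≃ᵣ fromℚ 0ℚ
    least  : ∀ x → fromℚ 0ℚ <ᵣ x → x <ᵣ π → ¬ sin x ≃ᵣ fromℚ 0ℚ

record ℂ : Set where
  constructor _+𝐢_
  field
    re im : ℝ

open ℂ public

infix 4 _≃ᶜ_
infixl 6 _+ᶜ_

_≃ᶜ_ : Rel ℂ 0ℓ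
z ≃ᶜ w = re z ≃ᵣ re w × im z ≃ᵣ im w

_+ᶜ_ : ℂ → ℂ → ℂ
z +ᶜ w = (re z +ᵣ re w) +𝐢 (im z +ᵣ im w)

fromℚᶜ : ℚ → ℂ
fromℚᶜ q = fromℚ q +𝐢 fromℚ 0ℚ

module _ {n : ℕ} .{{_ : ℕ.NonZero n}} where

  [_]ₙ : ℤ → Fin n
  [ a ]ₙ = fromℕ< (n%ℕd<d a n)

  _−ₙ_ : Fin n → Fin n → Fin n
  h −ₙ g = [ + toℕ h ℤ.- + toℕ g ]ₙ

elements : ∀ {n} → Subset n → List (Fin n)
elements S = filter (_∈? S) (allFin _)

-- Loops and asymmetry are not excluded here; Cay n S below is a simple graph
-- whenever S = −S and 0 ∉ S.
record Graph (n : ℕ) : Set₁ where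
  field
    Adj  : Rel (Fin n) 0ℓ
    adj? : Decidable Adj

closedNeighbourhood : ∀ {n} → Graph n → Fin n → List (Fin n)
closedNeighbourhood Γ u = filter (λ v → (v ≟ᶠ u) ⊎-dec Graph.adj? Γ u v) (allFin _)

-- Bijections V → {1,…,n} are given as ℓ : V ⤖ Fin n, with labels 1 + toℕ (ℓ v).
ClosedDistanceMagic : ∀ {n} → Graph n → Set
ClosedDistanceMagic {n} Γ =
  Σ[ ℓ ∈ Fin n ⤖ Fin n ] ∃[ r ] (1 ℕ.≤ r × ∀ u →
    sum (map (λ v → suc (toℕ (Bijection.to ℓ v))) (closedNeighbourhood Γ u)) ≡ r)

Cay : ∀ n .{{_ : ℕ.NonZero n}} → Subset n → Graph n
Cay n S = record
  { Adj  = λ g h → (h −ₙ g) ∈ S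
  ; adj? = λ g h → (h −ₙ g) ∈? S
  }

connectionSet : ∀ n .{{_ : ℕ.NonZero n}} → ℕ → Subset n
connectionSet n c =
  ⁅ [ + 1 ]ₙ ⁆ ∪ ⁅ [ ℤ.- + 1 ]ₙ ⁆ ∪ ⁅ [ + c ]ₙ ⁆ ∪ ⁅ [ ℤ.- + c ]ₙ ⁆ ∪ ⁅ [ + (n ℕ./ 2) ]ₙ ⁆

-- The set {a, b}.
⟨_,_⟩ : ℝ → ℝ → Pred ℝ 0ℓ
⟨ a , b ⟩ x = x ≃ᵣ a ⊎ x ≃ᵣ b

module Characters (π : ℝ) (n : ℕ) .{{_ : ℕ.NonZero n}} where

  χ : Fin n → Fin n → ℂ
  χ j x = cos θ +𝐢 sin θ
    where θ = (+ (2 ℕ.* toℕ x ℕ.* toℕ j) / n) · π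

  χ[_] : Fin n → Subset n → ℂ
  χ[ j ] S = foldr _+ᶜ_ (fromℚᶜ 0ℚ) (map (χ j) (elements S))

  𝒥 : Subset n → Pred (Fin n) 0ℓ
  𝒥 S j = χ[ j ] S ≃ᶜ fromℚᶜ (- 1ℚ)

  ±2π/3+2πk : Sign → ℤ → ℝ
  ±2π/3+2πk σ k = ((σ ℤ.◃ 2) / 3) · π +ᵣ ((+ 2 ℤ.* k) / 1) · π

  Type2 : ℕ → Pred (Fin n) 0ℓ
  Type2 c j =
    𝒥 (connectionSet n c) j × 2 ∣ toℕ j ×
    ∃[ σ₁ ] ∃[ σ₂ ] ∃[ k₁ ] ∃[ k₂ ]
      ⟨ (+ (2 ℕ.* toℕ j) / n) · π , (+ (2 ℕ.* toℕ j ℕ.* c) / n) · π ⟩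
        ≐ ⟨ ±2π/3+2πk σ₁ k₁ , ±2π/3+2πk σ₂ k₂ ⟩

module Submission where

-- The angle 2πb/n is congruent to ±2π/3 modulo 2π iff b/n ∈ ±1/3 + ℤ, because π ≠ 0 makes
-- q ↦ qπ injective on ℚ.  For b = j < n this leaves n/3 and 2n/3; for b = jc it then forces
-- 3 ∤ c.  Conversely n/3 and 2n/3 are interchanged by j ↦ n − j, which preserves type 2
-- since χ_{n−j} is the complex conjugate of χ_j and −1 is real.
-- Conjugation needs the period 2π of cos and sin.  It follows from sin π = 0 and the
-- addition formulas, which are the Cauchy product of the Taylor series: the products of
-- partial sums are sums over the square k, l < n, the partial sums at a + b are sums over the
-- triangle k + l < n, and the difference is dominated by a tail of the exponential series.

open import Defs
open import Data.Empty using (⊥-elim)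
open import Data.Fin.Base using (Fin; toℕ)
open import Data.Fin.Properties using (toℕ<n; toℕ-injective)
open import Data.Integer.Base as ℤ using (ℤ)
import Data.Integer.Properties as ℤₚ
import Data.Integer.Solver as ℤ-Solver
open import Data.List.Base using (List; []; _∷_; foldr; map)
open import Data.Nat.Base as ℕ using (ℕ; zero; suc; NonZero)
open import Data.Nat.Divisibility using (_∣_; _∤_; divides; ∣m+n∣m⇒∣n; ∣n⇒∣m*n; _∣?_)
open import Data.Nat.DivMod using (m*n/n≡m)
import Data.Nat.Properties as ℕₚ
import Data.Nat.Solver as ℕ-Solver
open import Data.Product.Base using (_×_; _,_; proj₁; proj₂; ∃; ∃-syntax)
open import Data.Rational.Solver using (module +-*-Solver)
import Data.Rational.Unnormalised.Base as ℚᵘ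
import Data.Rational.Unnormalised.Properties as ℚᵘₚ
open import Data.Sign.Base using (Sign; opposite)
open import Data.Sum.Base using (_⊎_; inj₁; inj₂; [_,_]′)
open import Function.Base using (_∘_)
open import Function.Bundles using (_⇔_; mk⇔)
open import Level using (0ℓ)
open import Relation.Binary.PropositionalEquality
open import Relation.Nullary.Decidable.Core using (yes; no; from-no)
open import Relation.Nullary.Negation.Core using (contradiction)
open import Relation.Unary using (Pred)

open ≡-Reasoning

module _ where
  open import Data.Rational.Base hiding (NonZero)
  open import Data.Rational.Properties
  open +-*-Solver

  ∑ : ℕ → (ℕ → ℚ) → ℚ
  ∑ zero    f = 0ℚ
  ∑ (suc n) f = f 0 + ∑ n (f ∘ suc)

  antidiagonal triangle : ℕ → (ℕ → ℕ → ℚ) → ℚ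
  antidiagonal zero    F = F 0 0
  antidiagonal (suc n) F = F 0 (suc n) + antidiagonal n (F ∘ suc)
  triangle zero    F = 0ℚ
  triangle (suc n) F = ∑ (suc n) (F 0) + triangle n (F ∘ suc)

  rectangle : ℕ → ℕ → (ℕ → ℕ → ℚ) → ℚ
  rectangle m n F = ∑ m (λ k → ∑ n (F k))

  ∑-snoc : ∀ n f → ∑ (suc n) f ≡ ∑ n f + f n
  ∑-snoc zero    f = +-comm (f 0) 0ℚ
  ∑-snoc (suc n) f = trans (cong (f 0 +_) (∑-snoc n (f ∘ suc)))
    (sym (+-assoc (f 0) (∑ n (f ∘ suc)) (f (suc n))))

  ∑-cong : ∀ n {f g} → (∀ k → f k ≡ g k) → ∑ n f ≡ ∑ n g
  ∑-cong zero    h = refl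
  ∑-cong (suc n) h = cong₂ _+_ (h 0) (∑-cong n (h ∘ suc))

  ∑-- : ∀ n f g → ∑ n (λ k → f k - g k) ≡ ∑ n f - ∑ n g
  ∑-- zero    f g = refl
  ∑-- (suc n) f g = trans (cong (f 0 - g 0 +_) (∑-- n (f ∘ suc) (g ∘ suc)))
    (solve 4 (λ a b c d → (a :- b) :+ (c :- d) := (a :+ c) :- (b :+ d)) refl
      (f 0) (g 0) (∑ n (f ∘ suc)) (∑ n (g ∘ suc)))

  ∑-+ : ∀ n f g → ∑ n (λ k → f k + g k) ≡ ∑ n f + ∑ n g
  ∑-+ zero    f g = refl
  ∑-+ (suc n) f g = trans (cong (f 0 + g 0 +_) (∑-+ n (f ∘ suc) (g ∘ suc)))
    (solve 4 (λ a b c d → (a :+ b) :+ (c :+ d) := (a :+ c) :+ (b :+ d)) refl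
      (f 0) (g 0) (∑ n (f ∘ suc)) (∑ n (g ∘ suc)))

  ∑-*ˡ : ∀ n c f → ∑ n (λ k → c * f k) ≡ c * ∑ n f
  ∑-*ˡ zero    c f = sym (*-zeroʳ c)
  ∑-*ˡ (suc n) c f = trans (cong (c * f 0 +_) (∑-*ˡ n c (f ∘ suc)))
    (sym (*-distribˡ-+ c (f 0) (∑ n (f ∘ suc))))

  ∑-mono-length : ∀ m i {f} → (∀ k → 0ℚ ≤ f k) → ∑ m f ≤ ∑ (i ℕ.+ m) f
  ∑-mono-length m zero    0≤f = ≤-refl
  ∑-mono-length m (suc i) {f} 0≤f = ≤-trans (∑-mono-length m i 0≤f)
    (≤-trans (p≤p+q (0≤f (i ℕ.+ m))) (≤-reflexive (sym (∑-snoc (i ℕ.+ m) f))))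

  ∑-tail : ∀ m i {f g} → (∀ k → ∣ f k ∣ ≤ g k) →
    ∣ ∑ (i ℕ.+ m) f - ∑ m f ∣ ≤ ∑ (i ℕ.+ m) g - ∑ m g
  ∑-tail m zero {f} {g} h = ≤-trans (abs-0 (+-inverseʳ (∑ m f)))
    (≤-reflexive (sym (+-inverseʳ (∑ m g))))
  ∑-tail m (suc i) {f} {g} h = subst₂ _≤_
    (cong ∣_∣ (shift f)) (shift g)
    (≤-trans (∣p+q∣≤∣p∣+∣q∣ (∑ (i ℕ.+ m) f - ∑ m f) (f (i ℕ.+ m)))
      (+-mono-≤ (∑-tail m i h) (h (i ℕ.+ m))))
    where
    shift : ∀ u → ∑ (i ℕ.+ m) u - ∑ m u + u (i ℕ.+ m) ≡ ∑ (suc i ℕ.+ m) u - ∑ m u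
    shift u = trans
      (solve 3 (λ a b c → a :- b :+ c := a :+ c :- b) refl (∑ (i ℕ.+ m) u) (∑ m u) (u (i ℕ.+ m)))
      (cong (_- ∑ m u) (sym (∑-snoc (i ℕ.+ m) u)))

  rectangle-product : ∀ m n f g → rectangle m n (λ k l → f k * g l) ≡ ∑ m f * ∑ n g
  rectangle-product m n f g = trans
    (∑-cong m (λ k → trans (∑-*ˡ n (f k) g) (*-comm (f k) (∑ n g))))
    (trans (∑-*ˡ m (∑ n g) f) (*-comm (∑ n g) (∑ m f)))

  triangle-suc : ∀ n F → triangle (suc n) F ≡ triangle n F + antidiagonal n F
  triangle-suc zero    F = solve 1 (λ a → (a :+ con 0ℚ) :+ con 0ℚ := con 0ℚ :+ a) refl (F 0 0)
  triangle-suc (suc n) F = trans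
    (cong₂ _+_ (∑-snoc (suc n) (F 0)) (triangle-suc n (F ∘ suc)))
    (solve 4 (λ a b c d → (a :+ b) :+ (c :+ d) := (a :+ c) :+ (b :+ d)) refl
      (∑ (suc n) (F 0)) (F 0 (suc n)) (triangle n (F ∘ suc)) (antidiagonal n (F ∘ suc)))

  rectangle-triangle : ∀ m i {F G : ℕ → ℕ → ℚ} → (∀ k l → ∣ F k l ∣ ≤ G k l) →
    ∣ rectangle m (i ℕ.+ m) F - triangle m F ∣ ≤ rectangle m (i ℕ.+ m) G - triangle m G
  rectangle-triangle zero    i h = ≤-refl
  rectangle-triangle (suc m) i {F} {G} h rewrite ℕₚ.+-suc i m =
    subst₂ _≤_ (cong ∣_∣ (swap (s F) (t F) (u F) (v F))) (swap (s G) (t G) (u G) (v G))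
      (≤-trans (∣p+q∣≤∣p∣+∣q∣ (s F - u F) (t F - v F))
        (+-mono-≤ first (rectangle-triangle m (suc i) (h ∘ suc))))
    where
    s t u v : (ℕ → ℕ → ℚ) → ℚ
    s H = ∑ (suc (i ℕ.+ m)) (H 0)
    t H = rectangle m (suc (i ℕ.+ m)) (H ∘ suc)
    u H = ∑ (suc m) (H 0)
    v H = triangle m (H ∘ suc)
    swap : ∀ a b c d → (a - c) + (b - d) ≡ (a + b) - (c + d)
    swap = solve 4 (λ a b c d → (a :- c) :+ (b :- d) := (a :+ b) :- (c :+ d)) refl
    first : ∣ s F - u F ∣ ≤ s G - u G
    first = subst (λ z → ∣ ∑ z (F 0) - u F ∣ ≤ ∑ z (G 0) - u G) (ℕₚ.+-suc i m)
      (∑-tail (suc m) i (h 0))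

  rectangle≤triangle : ∀ m n {F} → (∀ k l → 0ℚ ≤ F k l) →
    rectangle m n F ≤ triangle (m ℕ.+ n) F
  rectangle≤triangle zero    n 0≤F = triangle-nonneg n 0≤F
    where
    triangle-nonneg : ∀ n {F} → (∀ k l → 0ℚ ≤ F k l) → 0ℚ ≤ triangle n F
    triangle-nonneg zero    0≤F = ≤-refl
    triangle-nonneg (suc n) {F} 0≤F = +-nonneg
      (subst (λ z → 0ℚ ≤ ∑ z (F 0)) (ℕₚ.+-identityʳ (suc n)) (∑-mono-length 0 (suc n) (0≤F 0)))
      (triangle-nonneg n (0≤F ∘ suc))
  rectangle≤triangle (suc m) n 0≤F = +-mono-≤
    (∑-mono-length n (suc m) (0≤F 0)) (rectangle≤triangle m n (0≤F ∘ suc))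

  antidiagonal-cong : ∀ n {F G} → (∀ k l → k ℕ.+ l ≡ n → F k l ≡ G k l) →
    antidiagonal n F ≡ antidiagonal n G
  antidiagonal-cong zero    h = h 0 0 refl
  antidiagonal-cong (suc n) h = cong₂ _+_ (h 0 (suc n) refl)
    (antidiagonal-cong n (λ k l e → h (suc k) l (cong suc e)))

  antidiagonal-+ : ∀ n F G →
    antidiagonal n (λ k l → F k l + G k l) ≡ antidiagonal n F + antidiagonal n G
  antidiagonal-+ zero    F G = refl
  antidiagonal-+ (suc n) F G = trans
    (cong (F 0 (suc n) + G 0 (suc n) +_) (antidiagonal-+ n (F ∘ suc) (G ∘ suc)))
    (solve 4 (λ a b c d → (a :+ b) :+ (c :+ d) := (a :+ c) :+ (b :+ d)) refl
      (F 0 (suc n)) (G 0 (suc n)) (antidiagonal n (F ∘ suc)) (antidiagonal n (G ∘ suc)))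

  antidiagonal-*ˡ : ∀ n c F → antidiagonal n (λ k l → c * F k l) ≡ c * antidiagonal n F
  antidiagonal-*ˡ zero    c F = refl
  antidiagonal-*ˡ (suc n) c F = trans (cong (c * F 0 (suc n) +_) (antidiagonal-*ˡ n c (F ∘ suc)))
    (sym (*-distribˡ-+ c (F 0 (suc n)) (antidiagonal n (F ∘ suc))))

  antidiagonal-snoc : ∀ n F →
    antidiagonal (suc n) F ≡ antidiagonal n (λ k l → F k (suc l)) + F (suc n) 0
  antidiagonal-snoc zero    F = refl
  antidiagonal-snoc (suc n) F = trans (cong (F 0 (2 ℕ.+ n) +_) (antidiagonal-snoc n (F ∘ suc)))
    (sym (+-assoc (F 0 (2 ℕ.+ n)) (antidiagonal n (λ k l → F (suc k) (suc l))) (F (2 ℕ.+ n) 0)))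

  nat-+ : ∀ k l → nat (k ℕ.+ l) ≡ nat k + nat l
  nat-+ zero    l = sym (+-identityˡ (nat l))
  nat-+ (suc k) l = trans (nat-suc (k ℕ.+ l)) (trans (cong (_+ 1ℚ) (nat-+ k l))
    (trans (solve 2 (λ a b → a :+ b :+ con 1ℚ := a :+ con 1ℚ :+ b) refl (nat k) (nat l))
      (cong (_+ nat l) (sym (nat-suc k)))))

  -- Both sides satisfy (n + 1) s (n + 1) ≡ (a + b) s n: split n + 1 into k + l
  -- and use the recurrence of term on either factor.
  term-+ : ∀ n a b → antidiagonal n (λ k l → term k a * term l b) ≡ term n (a + b)
  term-+ zero    a b = refl
  term-+ (suc n) a b = begin
    X                                   ≡⟨ *-identityʳ X ⟨
    X * 1ℚ                              ≡⟨ cong (X *_) (recip*nat n) ⟨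
    X * (recip n * nat (suc n))         ≡⟨ solve 3 (λ x r m → x :* (r :* m) := m :* x :* r) refl
                                             X (recip n) (nat (suc n)) ⟩
    nat (suc n) * X * recip n           ≡⟨ cong (_* recip n) recurrence ⟩
    antidiagonal n F * (a + b) * recip n ≡⟨ cong (λ z → z * (a + b) * recip n) (term-+ n a b) ⟩
    term n (a + b) * (a + b) * recip n  ∎
    where
    F K L : ℕ → ℕ → ℚ
    F k l = term k a * term l b
    K k l = nat k * F k l
    L k l = nat l * F k l
    X = antidiagonal (suc n) F
    first : antidiagonal (suc n) K ≡ a * antidiagonal n F
    first = begin
      0ℚ * F 0 (suc n) + antidiagonal n (K ∘ suc)
        ≡⟨ cong₂ _+_ (*-zeroˡ (F 0 (suc n))) (antidiagonal-cong n λ k l _ →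
             trans (sym (*-assoc (nat (suc k)) (term (suc k) a) (term l b)))
               (trans (cong (_* term l b) (trans (*-comm (nat (suc k)) (term (suc k) a)) (term-step k a)))
                 (solve 3 (λ t a s → t :* a :* s := a :* (t :* s)) refl (term k a) a (term l b)))) ⟩
      0ℚ + antidiagonal n (λ k l → a * F k l)  ≡⟨ +-identityˡ _ ⟩
      antidiagonal n (λ k l → a * F k l)       ≡⟨ antidiagonal-*ˡ n a F ⟩
      a * antidiagonal n F                     ∎
    second : antidiagonal (suc n) L ≡ b * antidiagonal n F
    second = begin
      antidiagonal (suc n) L
        ≡⟨ antidiagonal-snoc n L ⟩
      antidiagonal n (λ k l → L k (suc l)) + 0ℚ * F (suc n) 0
        ≡⟨ cong₂ _+_ (antidiagonal-cong n λ k l _ →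
             trans (solve 3 (λ m t s → m :* (t :* s) := t :* (s :* m)) refl
                 (nat (suc l)) (term k a) (term (suc l) b))
               (trans (cong (term k a *_) (term-step l b))
                 (solve 3 (λ t s b → t :* (s :* b) := b :* (t :* s)) refl (term k a) (term l b) b)))
             (*-zeroˡ (F (suc n) 0)) ⟩
      antidiagonal n (λ k l → b * F k l) + 0ℚ  ≡⟨ +-identityʳ _ ⟩
      antidiagonal n (λ k l → b * F k l)       ≡⟨ antidiagonal-*ˡ n b F ⟩
      b * antidiagonal n F                     ∎
    recurrence : nat (suc n) * X ≡ antidiagonal n F * (a + b)
    recurrence = begin
      nat (suc n) * X
        ≡⟨ antidiagonal-*ˡ (suc n) (nat (suc n)) F ⟨
      antidiagonal (suc n) (λ k l → nat (suc n) * F k l)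
        ≡⟨ antidiagonal-cong (suc n) (λ k l e → trans
             (cong (_* F k l) (trans (cong nat (sym e)) (nat-+ k l)))
             (*-distribʳ-+ (F k l) (nat k) (nat l))) ⟩
      antidiagonal (suc n) (λ k l → K k l + L k l)
        ≡⟨ antidiagonal-+ (suc n) K L ⟩
      antidiagonal (suc n) K + antidiagonal (suc n) L
        ≡⟨ cong₂ _+_ first second ⟩
      a * antidiagonal n F + b * antidiagonal n F
        ≡⟨ solve 3 (λ a b s → a :* s :+ b :* s := s :* (a :+ b)) refl a b (antidiagonal n F) ⟩
      antidiagonal n F * (a + b) ∎

  partialSum-∑ : ∀ D n x → partialSum D n x ≡ ∑ n (λ k → D k * term k x)
  partialSum-∑ D zero    x = refl
  partialSum-∑ D (suc n) x = trans (cong (_+ D n * term n x) (partialSum-∑ D n x))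
    (sym (∑-snoc n (λ k → D k * term k x)))

  partialSum-triangle : ∀ D n a b →
    partialSum D n (a + b) ≡ triangle n (λ k l → D (k ℕ.+ l) * (term k a * term l b))
  partialSum-triangle D zero    a b = refl
  partialSum-triangle D (suc n) a b = trans
    (cong₂ _+_ (partialSum-triangle D n a b)
      (trans (cong (D n *_) (sym (term-+ n a b)))
        (trans (sym (antidiagonal-*ˡ n (D n) _))
          (antidiagonal-cong n λ k l e → cong (λ z → D z * (term k a * term l b)) (sym e)))))
    (sym (triangle-suc n _))

  E-triangle : ∀ n a b → E n (a + b) ≡ triangle n (λ k l → term k a * term l b)
  E-triangle zero    a b = refl
  E-triangle (suc n) a b = trans (cong₂ _+_ (E-triangle n a b) (sym (term-+ n a b)))
    (sym (triangle-suc n _))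

  partialSum-+-bound : ∀ {D} → (∀ k → ∣ D k ∣ ≤ 1ℚ) → ∀ {a b B} → ∣ a ∣ ≤ B → ∣ b ∣ ≤ B → ∀ n →
    ∣ rectangle n n (λ k l → D (k ℕ.+ l) * (term k a * term l b)) - partialSum D n (a + b) ∣
      ≤ E (n ℕ.+ n) (B + B) - E n (B + B)
  partialSum-+-bound {D} D≤1 {a} {b} {B} a≤B b≤B n = ≤-trans
    (subst (λ z → ∣ rectangle n n F - z ∣ ≤ rectangle n n G - triangle n G)
      (sym (partialSum-triangle D n a b)) (rectangle-triangle n 0 F≤G))
    (subst₂ (λ y z → rectangle n n G - triangle n G ≤ y - z)
      (sym (E-triangle (n ℕ.+ n) B B)) (sym (E-triangle n B B))
      (+-monoˡ-≤ (- triangle n G) (rectangle≤triangle n n 0≤G)))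
    where
    F G : ℕ → ℕ → ℚ
    F k l = D (k ℕ.+ l) * (term k a * term l b)
    G k l = term k B * term l B
    0≤B = ≤-trans (0≤∣p∣ a) a≤B
    0≤G : ∀ k l → 0ℚ ≤ G k l
    0≤G k l = *-nonneg (term-nonneg k 0≤B) (term-nonneg l 0≤B)
    F≤G : ∀ k l → ∣ F k l ∣ ≤ G k l
    F≤G k l = Series.coeff D≤1 (k ℕ.+ l) (term k a * term l b)
      (≤-trans (≤-reflexive (∣p*q∣≡∣p∣*∣q∣ (term k a) (term l b)))
        (*-mono (0≤∣p∣ (term k a)) (term-abs k a≤B) (0≤∣p∣ (term l b)) (term-abs l b≤B)))

  -- Addition formulas for the angles kπ/2.
  cosCoeff-+ : ∀ k l → cosCoeff (k ℕ.+ l) ≡ cosCoeff k * cosCoeff l - sinCoeff k * sinCoeff l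
  sinCoeff-+ : ∀ k l → sinCoeff (k ℕ.+ l) ≡ sinCoeff k * cosCoeff l + cosCoeff k * sinCoeff l
  cosCoeff-suc : ∀ l → cosCoeff (suc l) ≡ - sinCoeff l
  cosCoeff-suc 0 = refl
  cosCoeff-suc 1 = refl
  cosCoeff-suc (suc (suc l)) = cong -_ (cosCoeff-suc l)
  sinCoeff-suc : ∀ l → sinCoeff (suc l) ≡ cosCoeff l
  sinCoeff-suc 0 = refl
  sinCoeff-suc 1 = refl
  sinCoeff-suc (suc (suc l)) = cong -_ (sinCoeff-suc l)
  cosCoeff-+ 0 l = solve 2 (λ c s → c := con 1ℚ :* c :- con 0ℚ :* s) refl (cosCoeff l) (sinCoeff l)
  cosCoeff-+ 1 l = trans (cosCoeff-suc l)
    (solve 2 (λ c s → :- s := con 0ℚ :* c :- con 1ℚ :* s) refl (cosCoeff l) (sinCoeff l))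
  cosCoeff-+ (suc (suc k)) l = trans (cong -_ (cosCoeff-+ k l))
    (solve 4 (λ a b c d → :- (a :* c :- b :* d) := (:- a) :* c :- (:- b) :* d) refl
      (cosCoeff k) (sinCoeff k) (cosCoeff l) (sinCoeff l))
  sinCoeff-+ 0 l = solve 2 (λ c s → s := con 0ℚ :* c :+ con 1ℚ :* s) refl (cosCoeff l) (sinCoeff l)
  sinCoeff-+ 1 l = trans (sinCoeff-suc l)
    (solve 2 (λ c s → c := con 1ℚ :* c :+ con 0ℚ :* s) refl (cosCoeff l) (sinCoeff l))
  sinCoeff-+ (suc (suc k)) l = trans (cong -_ (sinCoeff-+ k l))
    (solve 4 (λ a b c d → :- (b :* c :+ a :* d) := (:- b) :* c :+ (:- a) :* d) refl
      (cosCoeff k) (sinCoeff k) (cosCoeff l) (sinCoeff l))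

  cosSum sinSum : ℕ → ℚ → ℚ
  cosSum = partialSum cosCoeff
  sinSum = partialSum sinCoeff

  product-rectangle : ∀ D D′ n a b →
    rectangle n n (λ k l → (D k * term k a) * (D′ l * term l b)) ≡ partialSum D n a * partialSum D′ n b
  product-rectangle D D′ n a b = trans (rectangle-product n n (λ k → D k * term k a) (λ l → D′ l * term l b))
    (sym (cong₂ _*_ (partialSum-∑ D n a) (partialSum-∑ D′ n b)))

  cosSum-rectangle : ∀ n a b →
    rectangle n n (λ k l → cosCoeff (k ℕ.+ l) * (term k a * term l b))
      ≡ cosSum n a * cosSum n b - sinSum n a * sinSum n b
  cosSum-rectangle n a b = trans
    (∑-cong n λ k → trans (∑-cong n λ l → trans (cong (_* (term k a * term l b)) (cosCoeff-+ k l))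
        (solve 6 (λ c s c′ s′ t u → (c :* c′ :- s :* s′) :* (t :* u)
            := (c :* t) :* (c′ :* u) :- (s :* t) :* (s′ :* u)) refl
          (cosCoeff k) (sinCoeff k) (cosCoeff l) (sinCoeff l) (term k a) (term l b)))
      (∑-- n _ _))
    (trans (∑-- n _ _)
      (cong₂ _-_ (product-rectangle cosCoeff cosCoeff n a b) (product-rectangle sinCoeff sinCoeff n a b)))

  sinSum-rectangle : ∀ n a b →
    rectangle n n (λ k l → sinCoeff (k ℕ.+ l) * (term k a * term l b))
      ≡ sinSum n a * cosSum n b + cosSum n a * sinSum n b
  sinSum-rectangle n a b = trans
    (∑-cong n λ k → trans (∑-cong n λ l → trans (cong (_* (term k a * term l b)) (sinCoeff-+ k l))
        (solve 6 (λ c s c′ s′ t u → (s :* c′ :+ c :* s′) :* (t :* u)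
            := (s :* t) :* (c′ :* u) :+ (c :* t) :* (s′ :* u)) refl
          (cosCoeff k) (sinCoeff k) (cosCoeff l) (sinCoeff l) (term k a) (term l b)))
      (∑-+ n _ _))
    (trans (∑-+ n _ _)
      (cong₂ _+_ (product-rectangle sinCoeff cosCoeff n a b) (product-rectangle cosCoeff sinCoeff n a b)))

  Eventually : Pred ℕ 0ℓ → Set
  Eventually P = ∃[ N ] (∀ n → N ℕ.≤ n → P n)

  eventually-map₂ : ∀ {P Q R : Pred ℕ 0ℓ} → (∀ n → P n → Q n → R n) →
    Eventually P → Eventually Q → Eventually R
  eventually-map₂ f (M , p) (N , q) = M ℕ.⊔ N , λ n h →
    f n (p n (ℕₚ.m⊔n≤o⇒m≤o M N h)) (q n (ℕₚ.m⊔n≤o⇒n≤o M N h))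

  eventually-map : ∀ {P Q : Pred ℕ 0ℓ} → (∀ n → P n → Q n) → Eventually P → Eventually Q
  eventually-map f (M , p) = M , λ n h → f n (p n h)

  Bounded Null : (ℕ → ℚ) → Set
  Bounded x = ∃[ B ] Eventually (λ n → ∣ x n ∣ ≤ B)
  Null x = ∀ ε → 0ℚ < ε → Eventually (λ n → ∣ x n ∣ < ε)

  cauchy⇒bounded : ∀ {x} → Cauchy x → Bounded x
  cauchy⇒bounded cx = let N , B , _ , h = eventuallyBounded cx in B , N , h

  const-bounded : ∀ q → Bounded (λ _ → q)
  const-bounded q = ∣ q ∣ , 0 , λ _ _ → ≤-refl

  bounded-+ : ∀ {x y} → Bounded x → Bounded y → Bounded (λ n → x n + y n)
  bounded-+ {x} {y} (A , p) (B , q) = A + B ,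
    eventually-map₂ (λ n h k → ≤-trans (∣p+q∣≤∣p∣+∣q∣ (x n) (y n)) (+-mono-≤ h k)) p q

  bounded-* : ∀ {x y} → Bounded x → Bounded y → Bounded (λ n → x n * y n)
  bounded-* {x} {y} (A , p) (B , q) = A * B ,
    eventually-map₂ (λ n h k → ≤-trans (≤-reflexive (∣p*q∣≡∣p∣*∣q∣ (x n) (y n)))
      (*-mono (0≤∣p∣ (x n)) h (0≤∣p∣ (y n)) k)) p q

  bounded-neg : ∀ {x} → Bounded x → Bounded (λ n → - x n)
  bounded-neg {x} (A , p) = A , eventually-map (λ n → subst (_≤ A) (sym (∣-p∣≡∣p∣ (x n)))) p

  null-cong : ∀ {x y} → Eventually (λ n → x n ≡ y n) → Null x → Null y
  null-cong e h ε 0<ε = eventually-map₂ (λ n → subst (λ z → ∣ z ∣ < ε)) e (h ε 0<ε)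

  null-≗ : ∀ {x y} → (∀ n → x n ≡ y n) → Null x → Null y
  null-≗ e = null-cong (0 , λ n _ → e n)

  null-0 : Null (λ _ → 0ℚ)
  null-0 ε 0<ε = 0 , λ _ _ → 0<ε

  null-+ : ∀ {x y} → Null x → Null y → Null (λ n → x n + y n)
  null-+ {x} {y} p q ε 0<ε = eventually-map₂
    (λ n h k → ≤-<-trans (∣p+q∣≤∣p∣+∣q∣ (x n) (y n))
      (subst (∣ x n ∣ + ∣ y n ∣ <_) (halves ε) (+-mono-< h k)))
    (p (½ * ε) (half-pos 0<ε)) (q (½ * ε) (half-pos 0<ε))

  null-neg : ∀ {x} → Null x → Null (λ n → - x n)
  null-neg {x} p ε 0<ε = eventually-map (λ n → subst (_< ε) (sym (∣-p∣≡∣p∣ (x n)))) (p ε 0<ε)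

  null-* : ∀ {x y} → Bounded x → Null y → Null (λ n → x n * y n)
  null-* {x} {y} (B , p) q ε 0<ε = let P , B≤P = archimedean B in
    eventually-map₂
      (λ n h k → ≤-<-trans
        (≤-trans (≤-reflexive (∣p*q∣≡∣p∣*∣q∣ (x n) (y n)))
          (*-mono (0≤∣p∣ (x n)) (≤-trans h (≤-trans B≤P (nat-mono (ℕₚ.n≤1+n P))))
            (0≤∣p∣ (y n)) ≤-refl))
        (subst (nat (suc P) * ∣ y n ∣ <_)
          (trans (sym (*-assoc (nat (suc P)) (recip P) ε))
            (trans (cong (_* ε) (trans (*-comm (nat (suc P)) (recip P)) (recip*nat P)))
              (*-identityˡ ε)))
          (*-monoʳ-<-pos (nat (suc P)) {{positive (nat-pos P)}} k)))
      p (q (recip P * ε) (*-pos (recip-pos P) 0<ε))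

  tail-vanishes : ∀ {B} → 0ℚ ≤ B → ∀ ε → 0ℚ < ε →
    Eventually (λ n → E (n ℕ.+ n) B - E n B < ε)
  tail-vanishes {B} 0≤B ε 0<ε = suc N , λ n N<n → ≤-<-trans (bound-at n N<n) δ<ε
    where
    open Majorant 0≤B
    δ = third * ε
    small = term-small (½ * δ) (half-pos (third-pos 0<ε))
    N = proj₁ small
    bound-at : ∀ n → suc N ℕ.≤ n → E (n ℕ.+ n) B - E n B ≤ δ
    bound-at n N<n = ≤-trans
      (+-monoʳ-≤ (E (n ℕ.+ n) B) (neg-antimono-≤ (E-mono-≤ N<n)))
      (≤-trans (subst (λ z → E z B - E (suc N) B ≤ term (suc N) B + term (suc N) B)
          (ℕₚ.m+[n∸m]≡n (ℕₚ.≤-trans N<n (ℕₚ.m≤m+n n n)))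
          (tail (suc N) (proj₁ (proj₂ small)) (n ℕ.+ n ℕ.∸ suc N)))
        (≤-trans (+-mono-≤ (proj₂ (proj₂ small)) (proj₂ (proj₂ small))) (≤-reflexive (halves δ))))
      where
      E-mono-≤ : ∀ {m n} → m ℕ.≤ n → E m B ≤ E n B
      E-mono-≤ {m} {n} h = subst (λ z → E m B ≤ E z B) (ℕₚ.m+[n∸m]≡n h) (E-mono 0≤B m (n ℕ.∸ m))
    δ<ε : δ < ε
    δ<ε = subst₂ _<_ (+-identityʳ δ) (trans (sym (+-assoc δ δ δ)) (thirds ε))
      (+-monoʳ-< δ (+-mono-< (third-pos 0<ε) (third-pos 0<ε)))

  partialSum-+-null : ∀ {D} → (∀ k → ∣ D k ∣ ≤ 1ℚ) → ∀ {a b} → Bounded a → Bounded b →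
    Null (λ n → rectangle n n (λ k l → D (k ℕ.+ l) * (term k (a n) * term l (b n)))
      - partialSum D n (a n + b n))
  partialSum-+-null D≤1 {a} {b} (A , N , p) (B , N′ , q) ε 0<ε = eventually-map₂
    (λ n k (h , h′) → ≤-<-trans (partialSum-+-bound D≤1 (≤-trans h A≤A+B) (≤-trans h′ B≤A+B) n) k)
    (tail-vanishes (+-nonneg 0≤A+B 0≤A+B) ε 0<ε)
    (eventually-map₂ (λ n h k → h , k) (N , p) (N′ , q))
    where
    0≤A = ≤-trans (0≤∣p∣ (a N)) (p N ℕₚ.≤-refl)
    0≤B = ≤-trans (0≤∣p∣ (b N′)) (q N′ ℕₚ.≤-refl)
    0≤A+B = +-nonneg 0≤A 0≤B
    A≤A+B : A ≤ A + B
    A≤A+B = p≤p+q 0≤B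
    B≤A+B : B ≤ A + B
    B≤A+B = subst (B ≤_) (+-comm B A) (p≤p+q 0≤A)

  Cos Sin : (ℕ → ℚ) → ℕ → ℚ
  Cos a n = cosSum n (a n)
  Sin a n = sinSum n (a n)

  cos-+ : ∀ {a b} → Bounded a → Bounded b →
    Null (λ n → (Cos a n * Cos b n - Sin a n * Sin b n) - Cos (λ k → a k + b k) n)
  cos-+ {a} {b} ba bb = null-≗ (λ n → cong (_- cosSum n (a n + b n)) (cosSum-rectangle n (a n) (b n)))
    (partialSum-+-null cosCoeff≤1 ba bb)

  sin-+ : ∀ {a b} → Bounded a → Bounded b →
    Null (λ n → (Sin a n * Cos b n + Cos a n * Sin b n) - Sin (λ k → a k + b k) n)
  sin-+ {a} {b} ba bb = null-≗ (λ n → cong (_- sinSum n (a n + b n)) (sinSum-rectangle n (a n) (b n)))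
    (partialSum-+-null sinCoeff≤1 ba bb)

  cosTerm-neg : ∀ k x → cosCoeff k * term k (- x) ≡ cosCoeff k * term k x
  cosTerm-neg 0 x = refl
  cosTerm-neg 1 x = trans (*-zeroˡ (term 1 (- x))) (sym (*-zeroˡ (term 1 x)))
  cosTerm-neg (suc (suc k)) x = step (cosCoeff k) (term k (- x)) (term k x) x (recip k) (recip (suc k))
    (cosTerm-neg k x)
    where
    step : ∀ c s t x p q → c * s ≡ c * t →
      - c * (s * - x * p * - x * q) ≡ - c * (t * x * p * x * q)
    step c s t x p q e = trans
      (solve 5 (λ c s x p q → :- c :* (s :* :- x :* p :* :- x :* q) := :- (c :* s) :* (x :* p :* x :* q))
        refl c s x p q)
      (trans (cong (λ z → - z * (x * p * x * q)) e)
        (solve 5 (λ c t x p q → :- (c :* t) :* (x :* p :* x :* q) := :- c :* (t :* x :* p :* x :* q))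
          refl c t x p q))

  sinTerm-neg : ∀ k x → sinCoeff k * term k (- x) ≡ - (sinCoeff k * term k x)
  sinTerm-neg 0 x = refl
  sinTerm-neg 1 x = solve 1
    (λ x → con 1ℚ :* (con 1ℚ :* :- x :* con 1ℚ) := :- (con 1ℚ :* (con 1ℚ :* x :* con 1ℚ)))
    refl x
  sinTerm-neg (suc (suc k)) x = step (sinCoeff k) (term k (- x)) (term k x) x (recip k) (recip (suc k))
    (sinTerm-neg k x)
    where
    step : ∀ c s t x p q → c * s ≡ - (c * t) →
      - c * (s * - x * p * - x * q) ≡ - (- c * (t * x * p * x * q))
    step c s t x p q e = trans
      (solve 5 (λ c s x p q → :- c :* (s :* :- x :* p :* :- x :* q) := :- (c :* s) :* (x :* p :* x :* q))
        refl c s x p q)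
      (trans (cong (λ z → - z * (x * p * x * q)) e)
        (solve 5 (λ c t x p q → :- (:- (c :* t)) :* (x :* p :* x :* q) := :- (:- c :* (t :* x :* p :* x :* q)))
          refl c t x p q))

  cosSum-neg : ∀ n x → cosSum n (- x) ≡ cosSum n x
  cosSum-neg zero    x = refl
  cosSum-neg (suc n) x = cong₂ _+_ (cosSum-neg n x) (cosTerm-neg n x)

  sinSum-neg : ∀ n x → sinSum n (- x) ≡ - sinSum n x
  sinSum-neg zero    x = refl
  sinSum-neg (suc n) x = trans (cong₂ _+_ (sinSum-neg n x) (sinTerm-neg n x))
    (sym (neg-distrib-+ (sinSum n x) (sinCoeff n * term n x)))

  partialSum-0 : ∀ D n → partialSum D (suc n) 0ℚ ≡ D 0
  partialSum-0 D zero    = trans (+-identityˡ (D 0 * 1ℚ)) (*-identityʳ (D 0))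
  partialSum-0 D (suc n) = trans (cong₂ _+_ (partialSum-0 D n)
      (solve 3 (λ d t r → d :* (t :* con 0ℚ :* r) := con 0ℚ) refl (D (suc n)) (term n 0ℚ) (recip n)))
    (+-identityʳ (D 0))

  partialSum-bounded : ∀ {D} → (∀ k → ∣ D k ∣ ≤ 1ℚ) → ∀ {a} → Bounded a →
    Bounded (λ n → partialSum D n (a n))
  partialSum-bounded {D} D≤1 {a} (B , N , h) = Majorant.bound 0≤B , N , λ n N≤n →
    ≤-trans (bound-at n (h n N≤n)) (Majorant.E≤bound 0≤B n)
    where
    0≤B = ≤-trans (0≤∣p∣ (a N)) (h N ℕₚ.≤-refl)
    bound-at : ∀ n {x} → ∣ x ∣ ≤ B → ∣ partialSum D n x ∣ ≤ E n B
    bound-at zero    h = ≤-refl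
    bound-at (suc n) {x} h = ≤-trans (∣p+q∣≤∣p∣+∣q∣ (partialSum D n x) (D n * term n x))
      (+-mono-≤ (bound-at n h) (Series.coeff D≤1 n (term n x) (term-abs n h)))

  cos-bounded : ∀ {a} → Bounded a → Bounded (Cos a)
  cos-bounded = partialSum-bounded cosCoeff≤1

  sin-bounded : ∀ {a} → Bounded a → Bounded (Sin a)
  sin-bounded = partialSum-bounded sinCoeff≤1

  cos²+sin² : ∀ {a} → Bounded a → Null (λ n → Cos a n * Cos a n + Sin a n * Sin a n - 1ℚ)
  cos²+sin² {a} ba = null-cong (1 , λ { (suc n) _ → cong₂ _-_
      (trans (cong₂ (λ y z → cosSum (suc n) (a (suc n)) * y - sinSum (suc n) (a (suc n)) * z)
          (cosSum-neg (suc n) (a (suc n))) (sinSum-neg (suc n) (a (suc n))))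
        (solve 2 (λ c s → c :* c :- s :* (:- s) := c :* c :+ s :* s) refl
          (cosSum (suc n) (a (suc n))) (sinSum (suc n) (a (suc n)))))
      (trans (cong (cosSum (suc n)) (+-inverseʳ (a (suc n)))) (partialSum-0 cosCoeff n)) })
    (cos-+ ba (bounded-neg ba))

  record Period (p : ℕ → ℚ) : Set where
    field
      bounded : Bounded p
      sin-0   : Null (Sin p)
      cos-1   : Null (λ n → Cos p n - 1ℚ)

  open Period

  period-0 : Period (λ _ → 0ℚ)
  period-0 = record
    { bounded = const-bounded 0ℚ
    ; sin-0   = null-cong {λ _ → 0ℚ} (1 , λ { (suc n) _ → sym (partialSum-0 sinCoeff n) }) null-0
    ; cos-1   = null-cong {λ _ → 1ℚ - 1ℚ}
        (1 , λ { (suc n) _ → cong (_- 1ℚ) (sym (partialSum-0 cosCoeff n)) }) null-0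
    }

  period-cong : ∀ {p q} → (∀ n → p n ≡ q n) → Period p → Period q
  period-cong e P = record
    { bounded = let B , N , h = bounded P in B , N , λ n k → subst (λ z → ∣ z ∣ ≤ B) (e n) (h n k)
    ; sin-0   = null-≗ (λ n → cong (sinSum n) (e n)) (sin-0 P)
    ; cos-1   = null-≗ (λ n → cong (λ z → cosSum n z - 1ℚ) (e n)) (cos-1 P)
    }

  module Shift {p} (P : Period p) {a} (ba : Bounded a) where

    cos-shift : Null (λ n → Cos (λ k → p k + a k) n - Cos a n)
    cos-shift = null-≗
      (λ n → solve 5 (λ cp sp c s r →
          :- ((cp :* c :- sp :* s) :- r) :+ c :* (cp :- con 1ℚ) :+ (:- s) :* sp := r :- c)
        refl (Cos p n) (Sin p n) (Cos a n) (Sin a n) (Cos (λ k → p k + a k) n))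
      (null-+ (null-+ (null-neg (cos-+ (bounded P) ba)) (null-* (cos-bounded ba) (cos-1 P)))
        (null-* (bounded-neg (sin-bounded ba)) (sin-0 P)))

    sin-shift : Null (λ n → Sin (λ k → p k + a k) n - Sin a n)
    sin-shift = null-≗
      (λ n → solve 5 (λ cp sp c s r →
          :- ((sp :* c :+ cp :* s) :- r) :+ c :* sp :+ s :* (cp :- con 1ℚ) := r :- s)
        refl (Cos p n) (Sin p n) (Cos a n) (Sin a n) (Sin (λ k → p k + a k) n))
      (null-+ (null-+ (null-neg (sin-+ (bounded P) ba)) (null-* (cos-bounded ba) (sin-0 P)))
        (null-* (sin-bounded ba) (cos-1 P)))

  period-+ : ∀ {p q} → Period p → Period q → Period (λ n → p n + q n)
  period-+ {p} {q} P Q = record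
    { bounded = bounded-+ (bounded P) (bounded Q)
    ; sin-0   = null-≗ (λ n → solve 2 (λ r s → (r :- s) :+ s := r) refl
                  (Sin (λ k → p k + q k) n) (Sin q n))
                  (null-+ (Shift.sin-shift P (bounded Q)) (sin-0 Q))
    ; cos-1   = null-≗ (λ n → solve 2 (λ r s → (r :- s) :+ (s :- con 1ℚ) := r :- con 1ℚ) refl
                  (Cos (λ k → p k + q k) n) (Cos q n))
                  (null-+ (Shift.cos-shift P (bounded Q)) (cos-1 Q))
    }

  period-multiple : ∀ {p} → Period p → ∀ x → Period (λ n → nat x * p n)
  period-multiple {p} P zero    = period-cong (λ n → sym (*-zeroˡ (p n))) period-0
  period-multiple {p} P (suc x) = period-cong
    (λ n → trans (solve 2 (λ m p → m :* p :+ p := (m :+ con 1ℚ) :* p) refl (nat x) (p n))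
      (cong (_* p n) (sym (nat-suc x))))
    (period-+ (period-multiple P x) P)

  period-double : ∀ {a} → Bounded a → Null (Sin a) → Period (λ n → a n + a n)
  period-double {a} ba s0 = record
    { bounded = bounded-+ ba ba
    ; sin-0   = null-≗
        (λ n → solve 3 (λ c s r → :- ((s :* c :+ c :* s) :- r) :+ (c :+ c) :* s := r)
          refl (Cos a n) (Sin a n) (Sin (λ k → a k + a k) n))
        (null-+ (null-neg (sin-+ ba ba))
          (null-* (bounded-+ (cos-bounded ba) (cos-bounded ba)) s0))
    ; cos-1   = null-≗
        (λ n → solve 3 (λ c s r →
            :- ((c :* c :- s :* s) :- r) :+ (c :* c :+ s :* s :- con 1ℚ) :+ (:- (s :+ s)) :* s
              := r :- con 1ℚ)
          refl (Cos a n) (Sin a n) (Cos (λ k → a k + a k) n))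
        (null-+ (null-+ (null-neg (cos-+ ba ba)) (cos²+sin² ba))
          (null-* (bounded-neg (bounded-+ (sin-bounded ba) (sin-bounded ba))) s0))
    }

  module Reflection {p} (P : Period p) {a b : ℕ → ℚ} (ba : Bounded a) (a+b≡p : ∀ n → a n + b n ≡ p n) where

    b≡p-a : ∀ n → p n + - a n ≡ b n
    b≡p-a n = trans (cong (λ z → z - a n) (sym (a+b≡p n)))
      (solve 2 (λ a b → a :+ b :- a := b) refl (a n) (b n))

    cos-reflect : Null (λ n → Cos b n - Cos a n)
    cos-reflect = null-≗ (λ n → cong₂ _-_ (cong (cosSum n) (b≡p-a n)) (cosSum-neg n (a n)))
      (Shift.cos-shift P {λ n → - a n} (bounded-neg ba))

    sin-reflect : Null (λ n → Sin b n + Sin a n)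
    sin-reflect = null-≗ (λ n → cong₂ _+_ (cong (sinSum n) (b≡p-a n))
        (trans (cong -_ (sinSum-neg n (a n))) (solve 1 (λ s → :- (:- s) := s) refl (Sin a n))))
      (Shift.sin-shift P {λ n → - a n} (bounded-neg ba))

  ·-injective : ∀ {π} → fromℚ 0ℚ <ᵣ π → ∀ {q r} → q · π ≃ᵣ r · π → q ≡ r
  ·-injective {π} (ε , 0<ε , N , ε≤π) {q} {r} h with q ≟ r
  ... | yes e = e
  ... | no q≢r = ⊥-elim (<-irrefl refl (<-≤-trans (proj₂ close n (ℕₚ.m≤n⊔m N M)) (≤-trans
      (*-monoˡ-≤-nonNeg ∣ q - r ∣ {{∣-∣-nonNeg (q - r)}} ε≤∣π∣)
      (≤-reflexive (trans (sym (∣p*q∣≡∣p∣*∣q∣ (q - r) (seq π n)))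
        (cong ∣_∣ (solve 3 (λ q r p → (q :- r) :* p := q :* p :- r :* p) refl q r (seq π n))))))))
    where
    0<∣q-r∣ : 0ℚ < ∣ q - r ∣
    0<∣q-r∣ = ≰⇒> λ ∣q-r∣≤0 → q≢r (trans
      (solve 2 (λ q r → q := (q :- r) :+ r) refl q r)
      (trans (cong (_+ r) (∣p∣≡0⇒p≡0 (q - r) (≤-antisym ∣q-r∣≤0 (0≤∣p∣ (q - r)))))
        (+-identityˡ r)))
    close = h (∣ q - r ∣ * ε) (*-pos 0<∣q-r∣ 0<ε)
    M = proj₁ close
    n = N ℕ.⊔ M
    ε≤∣π∣ : ε ≤ ∣ seq π n ∣
    ε≤∣π∣ = let h = subst (_≤ seq π n) (+-identityˡ ε) (ε≤π n (ℕₚ.m≤m⊔n N M)) in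
      ≤-trans h (≤-reflexive (sym (0≤p⇒∣p∣≡p (≤-trans (<⇒≤ 0<ε) h))))

  ≃ᵣ-sym : ∀ {x y} → x ≃ᵣ y → y ≃ᵣ x
  ≃ᵣ-sym {x} {y} h = null-≗ (λ n → solve 2 (λ a b → :- (a :- b) := b :- a) refl (seq x n) (seq y n))
    (null-neg h)

  ≃ᵣ-trans : ∀ {x y z} → x ≃ᵣ y → y ≃ᵣ z → x ≃ᵣ z
  ≃ᵣ-trans {x} {y} {z} h k = null-≗
    (λ n → solve 3 (λ a b c → (a :- b) :+ (b :- c) := a :- c) refl (seq x n) (seq y n) (seq z n))
    (null-+ h k)

  ≗⇒≃ᵣ : ∀ {x y} → (∀ n → seq x n ≡ seq y n) → x ≃ᵣ y
  ≗⇒≃ᵣ {x} {y} e = null-≗ (λ n → trans (sym (+-inverseʳ (seq x n))) (cong (λ z → seq x n - z) (e n))) null-0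

  conjugate-rational : ∀ {z w q} → re w ≃ᵣ re z → Null (λ n → seq (im w) n + seq (im z) n) →
    z ≃ᶜ fromℚᶜ q → w ≃ᶜ fromℚᶜ q
  conjugate-rational {z} {w} {q} r i (r′ , i′) =
    ≃ᵣ-trans {re w} {re z} {fromℚ q} r r′ ,
    null-≗ (λ n → solve 2 (λ a b → (a :+ b) :+ :- (b :- con 0ℚ) := a :- con 0ℚ) refl
        (seq (im w) n) (seq (im z) n))
      (null-+ i (null-neg i′))

open import Data.Integer.Base using (+_; -[1+_])

module _ where
  open import Data.Rational.Base hiding (NonZero)
  open import Data.Rational.Properties

  toℚᵘ-/ : ∀ i d → toℚᵘ (i / suc d) ℚᵘ.≃ ℚᵘ.mkℚᵘ i d
  toℚᵘ-/ i d = toℚᵘ-fromℚᵘ (ℚᵘ.mkℚᵘ i d)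

  /-≡⇒ : ∀ i d j e .{{_ : NonZero d}} .{{_ : NonZero e}} → i / d ≡ j / e → i ℤ.* + e ≡ j ℤ.* + d
  /-≡⇒ i (suc d) j (suc e) h with fromℚᵘ-injective {ℚᵘ.mkℚᵘ i d} {ℚᵘ.mkℚᵘ j e} h
  ... | ℚᵘ.*≡* eq = eq

  /-≡⇐ : ∀ i d j e .{{_ : NonZero d}} .{{_ : NonZero e}} → i ℤ.* + e ≡ j ℤ.* + d → i / d ≡ j / e
  /-≡⇐ i (suc d) j (suc e) h = fromℚᵘ-cong {ℚᵘ.mkℚᵘ i d} {ℚᵘ.mkℚᵘ j e} (ℚᵘ.*≡* h)

  /-+ : ∀ i j d .{{_ : NonZero d}} → i / d + j / 1 ≡ (i ℤ.+ j ℤ.* + d) / d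
  /-+ i j (suc d) = toℚᵘ-injective (ℚᵘₚ.≃-trans (toℚᵘ-homo-+ (i / suc d) (j / 1))
    (ℚᵘₚ.≃-trans (ℚᵘₚ.+-cong (toℚᵘ-/ i d) (toℚᵘ-/ j 0))
      (ℚᵘₚ.≃-trans (ℚᵘ.*≡* (cong₂ ℤ._*_ (cong (ℤ._+ j ℤ.* + suc d) (ℤₚ.*-identityʳ i))
          (cong (λ z → + suc z) (sym (ℕₚ.*-identityʳ d)))))
        (ℚᵘₚ.≃-sym (toℚᵘ-/ (i ℤ.+ j ℤ.* + suc d) d)))))

  /-complement : ∀ a b x n .{{_ : NonZero n}} → a ℕ.+ b ≡ x ℕ.* n → + a / n + + b / n ≡ nat x
  /-complement a b x n@(suc n-1) e = toℚᵘ-injective (ℚᵘₚ.≃-trans (toℚᵘ-homo-+ (+ a / n) (+ b / n))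
    (ℚᵘₚ.≃-trans (ℚᵘₚ.+-cong (toℚᵘ-/ (+ a) n-1) (toℚᵘ-/ (+ b) n-1))
      (ℚᵘₚ.≃-trans (ℚᵘ.*≡* (trans (ℤₚ.*-identityʳ _)
          (trans (sym (ℤₚ.*-distribʳ-+ (+ n) (+ a) (+ b)))
            (trans (cong (ℤ._* + n) (trans (cong +_ e) (ℤₚ.pos-* x n)))
              (trans (ℤₚ.*-assoc (+ x) (+ n) (+ n)) (cong (λ z → + x ℤ.* z) (sym (ℤₚ.pos-* n n))))))))
        (ℚᵘₚ.≃-sym (toℚᵘ-/ (+ x) 0)))))

-- b / n ∈ ±1/3 + ℤ
record Third (n b : ℕ) : Set where
  constructor mkThird
  field
    sign     : Sign
    shift    : ℤ
    equation : + b ℤ.* + 3 ≡ ((sign ℤ.◃ 1) ℤ.+ shift ℤ.* + 3) ℤ.* + n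

module _ where
  open ℤ-Solver.+-*-Solver

  ◃-double : ∀ σ → (σ ℤ.◃ 2) ≡ + 2 ℤ.* (σ ℤ.◃ 1)
  ◃-double Sign.+ = refl
  ◃-double Sign.- = refl

  ◃-opposite : ∀ σ → (opposite σ ℤ.◃ 1) ≡ ℤ.- (σ ℤ.◃ 1)
  ◃-opposite Sign.+ = refl
  ◃-opposite Sign.- = refl

  double-third : ∀ σ k n → ((σ ℤ.◃ 2) ℤ.+ (+ 2 ℤ.* k) ℤ.* + 3) ℤ.* n
    ≡ + 2 ℤ.* (((σ ℤ.◃ 1) ℤ.+ k ℤ.* + 3) ℤ.* n)
  double-third σ k n = trans (cong (λ z → (z ℤ.+ (+ 2 ℤ.* k) ℤ.* + 3) ℤ.* n) (◃-double σ))
    (solve 3 (λ s k n → (con (+ 2) :* s :+ (con (+ 2) :* k) :* con (+ 3)) :* n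
      := con (+ 2) :* ((s :+ k :* con (+ 3)) :* n)) refl (σ ℤ.◃ 1) k n)

  third-reflect : ∀ {n x a b} → a ℕ.+ b ≡ x ℕ.* n → Third n a → Third n b
  third-reflect {n} {x} {a} {b} a+b≡xn (mkThird σ k h) = mkThird (opposite σ) (+ x ℤ.- k) (begin
    + b ℤ.* + 3
      ≡⟨ solve 2 (λ a b → b :* con (+ 3) := (a :+ b) :* con (+ 3) :- a :* con (+ 3)) refl (+ a) (+ b) ⟩
    (+ a ℤ.+ + b) ℤ.* + 3 ℤ.- + a ℤ.* + 3
      ≡⟨ cong₂ (λ y z → y ℤ.* + 3 ℤ.- z) (trans (cong +_ a+b≡xn) (ℤₚ.pos-* x n)) h ⟩
    (+ x ℤ.* + n) ℤ.* + 3 ℤ.- ((σ ℤ.◃ 1) ℤ.+ k ℤ.* + 3) ℤ.* + n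
      ≡⟨ solve 4 (λ x n s k → (x :* n) :* con (+ 3) :- (s :+ k :* con (+ 3)) :* n
           := (:- s :+ (x :- k) :* con (+ 3)) :* n) refl (+ x) (+ n) (σ ℤ.◃ 1) k ⟩
    (ℤ.- (σ ℤ.◃ 1) ℤ.+ (+ x ℤ.- k) ℤ.* + 3) ℤ.* + n
      ≡⟨ cong (λ z → (z ℤ.+ (+ x ℤ.- k) ℤ.* + 3) ℤ.* + n) (◃-opposite σ) ⟨
    ((opposite σ ℤ.◃ 1) ℤ.+ (+ x ℤ.- k) ℤ.* + 3) ℤ.* + n ∎)

  third-not-integral : ∀ σ k w → (σ ℤ.◃ 1) ℤ.+ k ℤ.* + 3 ≢ w ℤ.* + 3
  third-not-integral σ k w h = from-no (3 ∣? 1) (divides ℤ.∣ w ℤ.- k ∣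
    (trans (sym (ℤₚ.abs-◃ σ 1)) (trans (cong ℤ.∣_∣ (begin
      σ ℤ.◃ 1
        ≡⟨ solve 2 (λ s k → s := (s :+ k) :- k) refl (σ ℤ.◃ 1) (k ℤ.* + 3) ⟩
      ((σ ℤ.◃ 1) ℤ.+ k ℤ.* + 3) ℤ.- k ℤ.* + 3
        ≡⟨ cong (ℤ._- k ℤ.* + 3) h ⟩
      w ℤ.* + 3 ℤ.- k ℤ.* + 3
        ≡⟨ solve 2 (λ w k → w :* con (+ 3) :- k :* con (+ 3) := (w :- k) :* con (+ 3)) refl w k ⟩
      (w ℤ.- k) ℤ.* + 3 ∎))
      (ℤₚ.abs-* (w ℤ.- k) (+ 3)))))

third⇒multiple : ∀ {n b} .{{_ : NonZero n}} → Third n b →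
  ∃[ v ] b ℕ.* 3 ≡ v ℕ.* n × 3 ∤ v
third⇒multiple {n@(suc _)} {b} (mkThird σ k h) with (σ ℤ.◃ 1) ℤ.+ k ℤ.* + 3 in eq
... | + v = v , ℤₚ.+-injective (trans (ℤₚ.pos-* b 3) (trans h (sym (ℤₚ.pos-* v n)))) ,
  λ { (divides w refl) → third-not-integral σ k (+ w) (trans eq (ℤₚ.pos-* w 3)) }
... | -[1+ v ] with trans (ℤₚ.pos-* b 3) h
...   | ()

third-values : ∀ {n j} .{{_ : NonZero n}} → j ℕ.< n → Third n j →
  3 ∣ n × (j ≡ n ℕ./ 3 ⊎ j ≡ 2 ℕ.* n ℕ./ 3)
third-values {n} {j} j<n t with third⇒multiple t
... | 0 , e , 3∤v = contradiction (divides 0 refl) 3∤v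
... | 1 , e , 3∤v = let j*3≡n = trans e (ℕₚ.*-identityˡ n) in
  divides j (sym j*3≡n) , inj₁ (trans (sym (m*n/n≡m j 3)) (cong (ℕ._/ 3) j*3≡n))
... | 2 , e , 3∤v =
  ∣m+n∣m⇒∣n {3} {2 ℕ.* n} (divides n (trans (ℕₚ.+-comm (2 ℕ.* n) n) (ℕₚ.*-comm 3 n)))
    (divides j (sym e)) ,
  inj₂ (trans (sym (m*n/n≡m j 3)) (cong (ℕ._/ 3) e))
... | suc (suc (suc v)) , e , 3∤v = contradiction
  (ℕₚ.≤-trans (ℕₚ.≤-reflexive (ℕₚ.*-comm n 3))
    (ℕₚ.≤-trans (ℕₚ.*-monoˡ-≤ n (ℕₚ.m≤m+n 3 v)) (ℕₚ.≤-reflexive (sym e))))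
  (ℕₚ.<⇒≱ (ℕₚ.*-monoˡ-< 3 j<n))

n/3+2n/3≡n : ∀ {n} → 3 ∣ n → n ℕ./ 3 ℕ.+ 2 ℕ.* n ℕ./ 3 ≡ n
n/3+2n/3≡n (divides m refl) = trans
  (cong₂ ℕ._+_ (m*n/n≡m m 3)
    (trans (cong (ℕ._/ 3) (sym (ℕₚ.*-assoc 2 m 3))) (m*n/n≡m (2 ℕ.* m) 3)))
  (ℕₚ.*-comm 3 m)

thirds-equal-or-complementary : ∀ {n i j} → 3 ∣ n →
  i ≡ n ℕ./ 3 ⊎ i ≡ 2 ℕ.* n ℕ./ 3 → j ≡ n ℕ./ 3 ⊎ j ≡ 2 ℕ.* n ℕ./ 3 →
  i ≡ j ⊎ i ℕ.+ j ≡ n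
thirds-equal-or-complementary 3∣n (inj₁ refl) (inj₁ refl) = inj₁ refl
thirds-equal-or-complementary 3∣n (inj₁ refl) (inj₂ refl) = inj₂ (n/3+2n/3≡n 3∣n)
thirds-equal-or-complementary {n} 3∣n (inj₂ refl) (inj₁ refl) =
  inj₂ (trans (ℕₚ.+-comm (2 ℕ.* n ℕ./ 3) (n ℕ./ 3)) (n/3+2n/3≡n 3∣n))
thirds-equal-or-complementary 3∣n (inj₂ refl) (inj₂ refl) = inj₁ refl

third-coprime : ∀ {n j c} .{{_ : NonZero n}} → Third n j → Third n (j ℕ.* c) → 3 ∤ c
third-coprime {n} {j} {c} s t 3∣c with third⇒multiple s | third⇒multiple t
... | v , e , _ | w , e′ , 3∤w = 3∤w (subst (3 ∣_) vc≡w (∣n⇒∣m*n v 3∣c))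
  where
  open ℕ-Solver.+-*-Solver
  vc≡w : v ℕ.* c ≡ w
  vc≡w = ℕₚ.*-cancelʳ-≡ (v ℕ.* c) w n (trans
    (solve 3 (λ v c n → v :* c :* n := v :* n :* c) refl v c n)
    (trans (cong (ℕ._* c) (sym e))
      (trans (solve 2 (λ j c → j :* con 3 :* c := j :* c :* con 3) refl j c) e′)))

module Type2Properties (π : ℝ) (isPi : IsPi π) (n : ℕ) .{{_ : NonZero n}} where
  open import Data.Rational.Base hiding (NonZero)
  open import Data.Rational.Properties
  open Characters π n
  open +-*-Solver
  open IsPi isPi

  value : Sign → ℤ → ℚ
  value σ k = (σ ℤ.◃ 2) / 3 + (+ 2 ℤ.* k) / 1

  ±2π/3-value : ∀ σ k → value σ k · π ≃ᵣ ±2π/3+2πk σ k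
  ±2π/3-value σ k = ≗⇒≃ᵣ {value σ k · π} {±2π/3+2πk σ k}
    (λ n → *-distribʳ-+ (seq π n) ((σ ℤ.◃ 2) / 3) ((+ 2 ℤ.* k) / 1))

  angle⇒third : ∀ {b} σ k → (+ (2 ℕ.* b) / n) · π ≃ᵣ ±2π/3+2πk σ k → Third n b
  angle⇒third {b} σ k h = mkThird σ k (ℤₚ.*-cancelˡ-≡ (+ 2) (+ b ℤ.* + 3) _ (begin
    + 2 ℤ.* (+ b ℤ.* + 3)    ≡⟨ ℤₚ.*-assoc (+ 2) (+ b) (+ 3) ⟨
    + 2 ℤ.* + b ℤ.* + 3      ≡⟨ cong (ℤ._* + 3) (ℤₚ.pos-* 2 b) ⟨
    + (2 ℕ.* b) ℤ.* + 3      ≡⟨ /-≡⇒ (+ (2 ℕ.* b)) n ((σ ℤ.◃ 2) ℤ.+ (+ 2 ℤ.* k) ℤ.* + 3) 3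
      (trans (·-injective {π} 0<π (≃ᵣ-trans {q} {s} {r} h (≃ᵣ-sym {r} {s} (±2π/3-value σ k))))
        (/-+ (σ ℤ.◃ 2) (+ 2 ℤ.* k) 3)) ⟩
    ((σ ℤ.◃ 2) ℤ.+ (+ 2 ℤ.* k) ℤ.* + 3) ℤ.* + n        ≡⟨ double-third σ k (+ n) ⟩
    + 2 ℤ.* (((σ ℤ.◃ 1) ℤ.+ k ℤ.* + 3) ℤ.* + n)        ∎))
    where
    q = (+ (2 ℕ.* b) / n) · π
    r = value σ k · π
    s = ±2π/3+2πk σ k

  third⇒angle : ∀ {b} (t : Third n b) → (+ (2 ℕ.* b) / n) · π ≃ᵣ ±2π/3+2πk (Third.sign t) (Third.shift t)
  third⇒angle {b} (mkThird σ k h) = subst (λ z → z · π ≃ᵣ ±2π/3+2πk σ k)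
    (trans (/-+ (σ ℤ.◃ 2) (+ 2 ℤ.* k) 3)
      (/-≡⇐ ((σ ℤ.◃ 2) ℤ.+ (+ 2 ℤ.* k) ℤ.* + 3) 3 (+ (2 ℕ.* b)) n (begin
        ((σ ℤ.◃ 2) ℤ.+ (+ 2 ℤ.* k) ℤ.* + 3) ℤ.* + n      ≡⟨ double-third σ k (+ n) ⟩
        + 2 ℤ.* (((σ ℤ.◃ 1) ℤ.+ k ℤ.* + 3) ℤ.* + n)      ≡⟨ cong (λ z → + 2 ℤ.* z) h ⟨
        + 2 ℤ.* (+ b ℤ.* + 3)                          ≡⟨ ℤₚ.*-assoc (+ 2) (+ b) (+ 3) ⟨
        + 2 ℤ.* + b ℤ.* + 3                            ≡⟨ cong (ℤ._* + 3) (ℤₚ.pos-* 2 b) ⟨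
        + (2 ℕ.* b) ℤ.* + 3                            ∎)))
    (±2π/3-value σ k)

  type2⇒thirds : ∀ {c j} → Type2 c j → Third n (toℕ j) × Third n (toℕ j ℕ.* c)
  type2⇒thirds {c} {j} (_ , _ , σ₁ , σ₂ , k₁ , k₂ , ⊆ , _) =
    [ angle⇒third σ₁ k₁ , angle⇒third σ₂ k₂ ]′
      (⊆ {a} (inj₁ (≗⇒≃ᵣ {a} {a} λ _ → refl))) ,
    [ angle⇒third′ σ₁ k₁ , angle⇒third′ σ₂ k₂ ]′
      (⊆ {b} (inj₂ (≗⇒≃ᵣ {b} {b} λ _ → refl)))
    where
    a = (+ (2 ℕ.* toℕ j) / n) · π
    b = (+ (2 ℕ.* toℕ j ℕ.* c) / n) · π
    angle⇒third′ : ∀ σ k → b ≃ᵣ ±2π/3+2πk σ k → Third n (toℕ j ℕ.* c)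
    angle⇒third′ σ k h = angle⇒third σ k
      (subst (λ z → (+ z / n) · π ≃ᵣ ±2π/3+2πk σ k) (ℕₚ.*-assoc 2 (toℕ j) c) h)

  thirds⇒type2 : ∀ {c j} → 𝒥 (connectionSet n c) j → 2 ∣ toℕ j →
    Third n (toℕ j) → Third n (toℕ j ℕ.* c) → Type2 c j
  thirds⇒type2 {c} {j} j∈𝒥 2∣j s@(mkThird σ₁ k₁ _) t@(mkThird σ₂ k₂ _) =
    j∈𝒥 , 2∣j , σ₁ , σ₂ , k₁ , k₂ ,
    (λ {x} → λ { (inj₁ h) → inj₁ (≃ᵣ-trans {x} {a} {a′} h a≃a′)
               ; (inj₂ h) → inj₂ (≃ᵣ-trans {x} {b} {b′} h b≃b′) }) ,
    (λ {x} → λ { (inj₁ h) → inj₁ (≃ᵣ-trans {x} {a′} {a} h (≃ᵣ-sym {a} {a′} a≃a′))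
               ; (inj₂ h) → inj₂ (≃ᵣ-trans {x} {b′} {b} h (≃ᵣ-sym {b} {b′} b≃b′)) })
    where
    a = (+ (2 ℕ.* toℕ j) / n) · π
    b = (+ (2 ℕ.* toℕ j ℕ.* c) / n) · π
    a′ = ±2π/3+2πk σ₁ k₁
    b′ = ±2π/3+2πk σ₂ k₂
    a≃a′ : a ≃ᵣ a′
    a≃a′ = third⇒angle s
    b≃b′ : b ≃ᵣ b′
    b≃b′ = subst (λ z → (+ z / n) · π ≃ᵣ b′) (sym (ℕₚ.*-assoc 2 (toℕ j) c)) (third⇒angle t)

  2π-period : Period (λ k → seq π k + seq π k)
  2π-period = period-double (cauchy⇒bounded (cauchy π))
    (null-≗ (λ k → solve 1 (λ s → s :- con 0ℚ := s) refl (Sin (seq π) k)) sinπ≃0)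

  module Conjugate {i j : Fin n} (i+j≡n : toℕ i ℕ.+ toℕ j ≡ n) where

    angle : Fin n → Fin n → ℚ
    angle i x = + (2 ℕ.* toℕ x ℕ.* toℕ i) / n

    module Term (x : Fin n) where
      angle-complement : ∀ k →
        angle i x * seq π k + angle j x * seq π k ≡ nat (toℕ x) * (seq π k + seq π k)
      angle-complement k = begin
        angle i x * p + angle j x * p ≡⟨ *-distribʳ-+ p (angle i x) (angle j x) ⟨
        (angle i x + angle j x) * p
          ≡⟨ cong (_* p) (/-complement (2 ℕ.* toℕ x ℕ.* toℕ i) _ (2 ℕ.* toℕ x) n
               (trans (sym (ℕₚ.*-distribˡ-+ (2 ℕ.* toℕ x) (toℕ i) (toℕ j)))
                 (cong (2 ℕ.* toℕ x ℕ.*_) i+j≡n))) ⟩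
        nat (2 ℕ.* toℕ x) * p
          ≡⟨ cong (_* p) (trans (nat-+ (toℕ x) (toℕ x ℕ.+ 0))
               (cong (λ z → nat (toℕ x) + nat z) (ℕₚ.+-identityʳ (toℕ x)))) ⟩
        (nat (toℕ x) + nat (toℕ x)) * p
          ≡⟨ solve 2 (λ a p → (a :+ a) :* p := a :* (p :+ p)) refl (nat (toℕ x)) p ⟩
        nat (toℕ x) * (p + p) ∎
        where
        p = seq π k

      open Reflection (period-multiple 2π-period (toℕ x))
        (bounded-* (const-bounded (angle i x)) (cauchy⇒bounded (cauchy π)))
        angle-complement public

    χ-sum : Fin n → List (Fin n) → ℂ
    χ-sum i xs = foldr _+ᶜ_ (fromℚᶜ 0ℚ) (map (χ i) xs)

    re-conjugate : ∀ xs → re (χ-sum j xs) ≃ᵣ re (χ-sum i xs)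
    re-conjugate []       = null-0
    re-conjugate (x ∷ xs) = null-≗
      (λ k → solve 4 (λ a b c d → (a :- b) :+ (c :- d) := (a :+ c) :- (b :+ d)) refl
        (seq (re (χ j x)) k) (seq (re (χ i x)) k) (seq (re (χ-sum j xs)) k) (seq (re (χ-sum i xs)) k))
      (null-+ (Term.cos-reflect x) (re-conjugate xs))

    im-conjugate : ∀ xs → Null (λ k → seq (im (χ-sum j xs)) k + seq (im (χ-sum i xs)) k)
    im-conjugate []       = null-0
    im-conjugate (x ∷ xs) = null-≗
      (λ k → solve 4 (λ a b c d → (a :+ b) :+ (c :+ d) := (a :+ c) :+ (b :+ d)) refl
        (seq (im (χ j x)) k) (seq (im (χ i x)) k) (seq (im (χ-sum j xs)) k) (seq (im (χ-sum i xs)) k))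
      (null-+ (Term.sin-reflect x) (im-conjugate xs))

    𝒥-conjugate : ∀ S → 𝒥 S i → 𝒥 S j
    𝒥-conjugate S = conjugate-rational {χ-sum i xs} {χ-sum j xs} { - 1ℚ }
      (re-conjugate xs) (im-conjugate xs)
      where xs = elements S

  type2-complement : ∀ {c i j} → 2 ∣ n → toℕ i ℕ.+ toℕ j ≡ n → Type2 c i → Type2 c j
  type2-complement {c} {i} {j} 2∣n i+j≡n τ@(i∈𝒥 , 2∣i , _) = let s , t = type2⇒thirds {c} {i} τ in
    thirds⇒type2 {c} {j} (Conjugate.𝒥-conjugate {i} {j} i+j≡n (connectionSet n c) i∈𝒥)
      (∣m+n∣m⇒∣n (subst (2 ∣_) (sym i+j≡n) 2∣n) 2∣i)
      (third-reflect {x = 1} (trans i+j≡n (sym (ℕₚ.*-identityˡ n))) s)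
      (third-reflect {x = c} (trans (sym (ℕₚ.*-distribʳ-+ c (toℕ i) (toℕ j)))
        (trans (cong (ℕ._* c) i+j≡n) (ℕₚ.*-comm n c))) t)

  type2-values : ∀ {c} j → Type2 c j → 3 ∣ n × (toℕ j ≡ n ℕ./ 3 ⊎ toℕ j ≡ 2 ℕ.* n ℕ./ 3)
  type2-values {c} j τ = third-values (toℕ<n j) (proj₁ (type2⇒thirds {c} {j} τ))

  type2-resp-≡ : ∀ {c i j} → i ≡ j → Type2 c i → Type2 c j
  type2-resp-≡ refl τ = τ

  type2-characterisation : ∀ {c i} → 2 ∣ n → Type2 c i →
    ∀ j → Type2 c j ⇔ (toℕ j ≡ n ℕ./ 3 ⊎ toℕ j ≡ 2 ℕ.* n ℕ./ 3)
  type2-characterisation {c} {i} 2∣n τ j = mk⇔ (λ t → proj₂ (type2-values {c} j t)) λ j-value →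
    transfer (thirds-equal-or-complementary (proj₁ i-value) (proj₂ i-value) j-value)
    where
    i-value : 3 ∣ n × (toℕ i ≡ n ℕ./ 3 ⊎ toℕ i ≡ 2 ℕ.* n ℕ./ 3)
    i-value = type2-values {c} i τ
    transfer : toℕ i ≡ toℕ j ⊎ toℕ i ℕ.+ toℕ j ≡ n → Type2 c j
    transfer (inj₁ i≡j)   = type2-resp-≡ {c} {i} {j} (toℕ-injective i≡j) τ
    transfer (inj₂ i+j≡n) = type2-complement {c} {i} {j} 2∣n i+j≡n τ

  type2⇒3∤ : ∀ {c i} → Type2 c i → 3 ∤ c
  type2⇒3∤ {c} {i} τ = let s , t = type2⇒thirds {c} {i} τ in third-coprime s t

open import Data.Nat.Base using (_≤_; _<_; _*_; _/_)

lemma4p5 : (π : ℝ) → IsPi π →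
    (n c : ℕ) .{{_ : NonZero n}} → 6 ≤ n → 2 ∣ n → 1 < c → c < n / 2 →
    ClosedDistanceMagic (Cay n (connectionSet n c)) →
    ∃ (Characters.Type2 π n c) →
    3 ∣ n ×
    (∀ j → Characters.Type2 π n c j ⇔ (toℕ j ≡ n / 3 ⊎ toℕ j ≡ 2 * n / 3)) ×
    3 ∤ c
lemma4p5 π isPi n c {{n≢0}} _ 2∣n _ _ _ (i , τ) =
  proj₁ (type2-values {c} i τ) , type2-characterisation {c} {i} 2∣n τ , type2⇒3∤ {c} {i} τ
  where open Type2Properties π isPi n {{n≢0}}
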